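{- Let $\mathbf{P}=\{p_n(x)\}_{n\ge0}$ be the Sheffer sequence for the pair $(g(t),f(t))$. Then, as formal power series in $t$ (with coefficients rational functions of $x$), $$\sum_{n=0}^{\infty}A_n(x;\mathbf{P})\frac{t^n}{n!}=\frac{(1-x)\,e^{\bar f((1-x)t)}}{g\big(\bar f((1-x)t)\big)}\cdot\frac{1}{1-x\,e^{\bar f((1-x)t)}}.$$
   Context: $g,f$ are formal power series over $\mathbb{C}$ with $g(0)\ne0$, $f(0)=0$, $f'(0)\ne0$; $\bar f$ is the compositional inverse of $f$. $\{p_n\}$ is Sheffer for $(g,f)$ iff $\sum_{n\ge0}p_n(x)\frac{t^n}{n!}=\frac{1}{g(\bar f(t))}e^{x\bar f(t)}$. The Eulerian numbers $A_{n,k}(\mathbf{P})$ ($0\le k\le n$) are the unique coefficients with $p_n(x)=\sum_{k=0}^{n}A_{n,k}(\mathbf{P})\binom{x+n-k-1}{n}$, where $\binom{y}{n}=y(y-1)\cdots(y-n+1)/n!$, and $A_n(x;\mathbf{P})=\sum_{k=0}^n A_{n,k}(\mathbf{P})x^k$. -}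

module Defs where

open import Level using (Level; _⊔_)
open import Algebra.Bundles using (CommutativeRing)
open import Algebra.Bundles.Raw using (RawRing)
open import Algebra.Apartness.Bundles using (HeytingCommutativeRing; HeytingField)
import Algebra.Apartness.Properties.HeytingCommutativeRing as HeytingProperties
import Algebra.Definitions.RawSemiring as RawSemiringDefinitions
import Algebra.Properties.Ring as RingProperties
import Algebra.Properties.CommutativeSemigroup as CommutativeSemigroupProperties
open import Data.Fin.Base using (Fin; toℕ)
open import Data.List.Base using (List; []; _∷_; map)
open import Data.Nat.Base as ℕ using (ℕ; zero; suc; _∸_; _!)
open import Data.Nat.Properties using (_!≢0)
open import Data.Product.Base using (∃; _,_; proj₁; proj₂)
open import Data.Sum.Base using (_⊎_; inj₁; inj₂)
open import Data.Vec.Base using (Vec; []; _∷_; head; lookup)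
open import Function.Base using (_∘_)
import Relation.Binary.Reasoning.Setoid as ≈-Reasoning

private
  variable
    c ℓ ℓ₁ ℓ₂ : Level

------------------------------------------------------------------------
-- Formal power series in t over a ring R, as coefficient sequences

module Series (R : RawRing c ℓ) where

  open RawRing R
  open RawSemiringDefinitions rawSemiring using (sum; _^_)

  infix  4 _≋_
  infixl 6 _⊕_ _⊖_
  infixl 7 _⊛_
  infixr 7 _·_
  infixl 8 _⊚_ _⟨_t⟩

  R⟦t⟧ : Set c
  R⟦t⟧ = ℕ → Carrier

  _≋_ : R⟦t⟧ → R⟦t⟧ → Set ℓ
  F ≋ G = ∀ n → F n ≈ G n

  const : Carrier → R⟦t⟧
  const a zero    = a
  const a (suc n) = 0#

  t : R⟦t⟧
  t 1 = 1#
  t _ = 0#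

  _⊕_ _⊖_ _⊛_ : R⟦t⟧ → R⟦t⟧ → R⟦t⟧
  (F ⊕ G) n = F n + G n
  (F ⊖ G) n = F n + (- G n)
  (F ⊛ G) n = sum {suc n} λ k → F (toℕ k) * G (n ∸ toℕ k)

  _·_ : Carrier → R⟦t⟧ → R⟦t⟧
  (a · F) n = a * F n

  rawRing : RawRing c ℓ
  rawRing = record
    { Carrier = R⟦t⟧
    ; _≈_     = _≋_
    ; _+_     = _⊕_
    ; _*_     = _⊛_
    ; -_      = λ F n → - F n
    ; 0#      = const 0#
    ; 1#      = const 1#
    }

  open RawSemiringDefinitions (RawRing.rawSemiring rawRing) public
    using () renaming (_^_ to _^ˢ_)

  -- F(G(t)).  Only meaningful when G has zero constant term: then Gᵏ has
  -- no terms below tᵏ, and the sum defining the n-th coefficient may stop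
  -- at k = n.
  _⊚_ : R⟦t⟧ → R⟦t⟧ → R⟦t⟧
  (F ⊚ G) n = sum {suc n} λ k → F (toℕ k) * (G ^ˢ toℕ k) n

  -- F(a t)
  _⟨_t⟩ : R⟦t⟧ → Carrier → R⟦t⟧
  (F ⟨ a t⟩) n = F n * a ^ n

  -- 1 / F, where u is the inverse of the constant term F 0.  The
  -- coefficients H₀, H₁, … solve H₀ = u and
  -- F₀ Hₙ₊₁ + F₁ Hₙ + … + Fₙ₊₁ H₀ = 0; reciprocalUpTo n lists Hₙ, …, H₀.
  module _ (u : Carrier) (F : R⟦t⟧) where

    reciprocalUpTo : ∀ n → Vec Carrier (suc n)
    reciprocalUpTo zero    = u ∷ []
    reciprocalUpTo (suc n) =
      - (u * sum {suc n} λ k → F (suc (toℕ k)) * lookup (reciprocalUpTo n) k)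
      ∷ reciprocalUpTo n

    reciprocal : R⟦t⟧
    reciprocal n = head (reciprocalUpTo n)

------------------------------------------------------------------------
-- The coefficient field.  In a Heyting field # plays the role of ≢; with
-- classical logic these are exactly the fields, with a # b iff a ≢ b.  The
-- complex numbers are the intended instance; nothing about them is used
-- beyond their being a field of characteristic zero.

commutativeRing : HeytingField c ℓ₁ ℓ₂ → CommutativeRing c ℓ₁
commutativeRing K = HeytingCommutativeRing.commutativeRing
  (HeytingField.heytingCommutativeRing K)

CharacteristicZero : HeytingField c ℓ₁ ℓ₂ → Set ℓ₂
CharacteristicZero K = ∀ n → .{{ℕ.NonZero n}} → n ×ⁿ 1# # 0#
  where
  open HeytingField K
  open RawSemiringDefinitions
    (RawRing.rawSemiring (CommutativeRing.rawRing (commutativeRing K)))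
    using () renaming (_×_ to _×ⁿ_)

module Sheffer (K : HeytingField c ℓ₁ ℓ₂) (char0 : CharacteristicZero K) where

  private
    module K = HeytingField K

    ring : CommutativeRing c ℓ₁
    ring = commutativeRing K

  open CommutativeRing ring public
    using (Carrier; _≈_; _+_; _*_; -_; 0#; 1#; rawRing)
  open CommutativeRing ring using
    ( refl; sym; trans; setoid; +-congˡ; +-congʳ; *-congˡ; +-assoc; +-comm
    ; +-identityˡ; +-identityʳ; *-assoc; *-comm; *-identityʳ; zeroˡ; zeroʳ
    ; -‿inverseʳ; -‿cong )
  open HeytingField K public using (_#_)
  open RawSemiringDefinitions (RawRing.rawSemiring rawRing)
    using () renaming (_×_ to _×ⁿ_)
  open HeytingProperties K.heytingCommutativeRing
    using (x-0≈x; 1#0; x#0y#0→xy#0; invertibleˡ⇒#; #-congʳ)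
  open RingProperties (CommutativeRing.ring ring)
    using (-0#≈0#)
  open CommutativeSemigroupProperties
    (CommutativeRing.+-commutativeSemigroup ring) using (x∙yz≈y∙xz)

  -- #⇒invertible yields an inverse of a - 0#, which is ≈ a.
  inverse : ∀ {a} → a # 0# → Carrier
  inverse a#0 = proj₁ (K.#⇒invertible a#0)

  1/_! : ℕ → Carrier
  1/ n ! = inverse (char0 (n !) {{n !≢0}})

  ----------------------------------------------------------------------
  -- K[x]: coefficient lists, constant coefficient first, compared
  -- coefficientwise (so trailing zeros are immaterial)

  K[x] : Set c
  K[x] = List Carrier

  coeff : K[x] → ℕ → Carrier
  coeff []      n       = 0#
  coeff (a ∷ p) zero    = a
  coeff (a ∷ p) (suc n) = coeff p n

  infixl 6 _+ₚ_
  infixl 7 _*ₚ_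

  _+ₚ_ : K[x] → K[x] → K[x]
  []      +ₚ q       = q
  (a ∷ p) +ₚ []      = a ∷ p
  (a ∷ p) +ₚ (b ∷ q) = (a + b) ∷ (p +ₚ q)

  _*ₚ_ : K[x] → K[x] → K[x]
  []      *ₚ q = []
  (a ∷ p) *ₚ q = map (a *_) q +ₚ (0# ∷ (p *ₚ q))

  polyRing : RawRing c ℓ₁
  polyRing = record
    { Carrier = K[x]
    ; _≈_     = λ p q → ∀ n → coeff p n ≈ coeff q n
    ; _+_     = _+ₚ_
    ; _*_     = _*ₚ_
    ; -_      = map -_
    ; 0#      = []
    ; 1#      = 1# ∷ []
    }

  C : Carrier → K[x]
  C a = a ∷ []

  x : K[x]
  x = 0# ∷ 1# ∷ []

  Nonzeroₚ : K[x] → Set ℓ₂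
  Nonzeroₚ p = ∃ λ n → coeff p n # 0#

  private
    coeff-+ : ∀ p q n → coeff (p +ₚ q) n ≈ coeff p n + coeff q n
    coeff-+ []      q       n       = sym (+-identityˡ _)
    coeff-+ (a ∷ p) []      n       = sym (+-identityʳ _)
    coeff-+ (a ∷ p) (b ∷ q) zero    = refl
    coeff-+ (a ∷ p) (b ∷ q) (suc n) = coeff-+ p q n

    coeff-map : ∀ a q n → coeff (map (a *_) q) n ≈ a * coeff q n
    coeff-map a []      n       = sym (zeroʳ a)
    coeff-map a (b ∷ q) zero    = refl
    coeff-map a (b ∷ q) (suc n) = coeff-map a q n

    coeff-*-suc : ∀ a p q n →
      coeff ((a ∷ p) *ₚ q) (suc n) ≈ a * coeff q (suc n) + coeff (p *ₚ q) n
    coeff-*-suc a p q n = trans (coeff-+ (map (a *_) q) (0# ∷ (p *ₚ q)) (suc n))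
      (+-congʳ (coeff-map a q (suc n)))

    coeff-*-zero : ∀ a p q → coeff ((a ∷ p) *ₚ q) 0 ≈ a * coeff q 0
    coeff-*-zero a p q = trans (coeff-+ (map (a *_) q) (0# ∷ (p *ₚ q)) 0)
      (trans (+-identityʳ _) (coeff-map a q 0))

    coeff-*-∷ : ∀ p b q n →
      coeff (p *ₚ (b ∷ q)) (suc n) ≈ coeff p (suc n) * b + coeff (p *ₚ q) n
    coeff-*-∷ []      b q n = sym (trans (+-identityʳ _) (zeroˡ b))
    coeff-*-∷ (a ∷ p) b q zero = begin
      coeff ((a ∷ p) *ₚ (b ∷ q)) 1             ≈⟨ coeff-*-suc a p (b ∷ q) 0 ⟩
      a * coeff q 0 + coeff (p *ₚ (b ∷ q)) 0   ≈⟨ +-congˡ (head-* p) ⟩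
      a * coeff q 0 + coeff p 0 * b            ≈⟨ +-comm _ _ ⟩
      coeff p 0 * b + a * coeff q 0            ≈⟨ +-congˡ (coeff-*-zero a p q) ⟨
      coeff p 0 * b + coeff ((a ∷ p) *ₚ q) 0   ∎
      where
      open ≈-Reasoning setoid
      head-* : ∀ p → coeff (p *ₚ (b ∷ q)) 0 ≈ coeff p 0 * b
      head-* []      = sym (zeroˡ b)
      head-* (a ∷ p) = coeff-*-zero a p (b ∷ q)
    coeff-*-∷ (a ∷ p) b q (suc n) = begin
      coeff ((a ∷ p) *ₚ (b ∷ q)) (suc (suc n))
        ≈⟨ coeff-*-suc a p (b ∷ q) (suc n) ⟩
      a * coeff q (suc n) + coeff (p *ₚ (b ∷ q)) (suc n)
        ≈⟨ +-congˡ (coeff-*-∷ p b q n) ⟩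
      a * coeff q (suc n) + (coeff p (suc n) * b + coeff (p *ₚ q) n)
        ≈⟨ x∙yz≈y∙xz _ _ _ ⟩
      coeff p (suc n) * b + (a * coeff q (suc n) + coeff (p *ₚ q) n)
        ≈⟨ +-congˡ (coeff-*-suc a p q n) ⟨
      coeff p (suc n) * b + coeff ((a ∷ p) *ₚ q) (suc n) ∎
      where open ≈-Reasoning setoid

    *#0⇒#0ʳ : ∀ {a b} → a * b # 0# → b # 0#
    *#0⇒#0ʳ {a} {b} ab#0 with K.#⇒invertible ab#0
    ... | u , u*ab≈1 , _ = invertibleˡ⇒# (u * a , (begin
      u * a * (b + - 0#)      ≈⟨ *-congˡ (x-0≈x b) ⟩
      u * a * b               ≈⟨ *-assoc u a b ⟩
      u * (a * b)             ≈⟨ *-congˡ (x-0≈x (a * b)) ⟨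
      u * (a * b + - 0#)      ≈⟨ u*ab≈1 ⟩
      1#                      ∎))
      where open ≈-Reasoning setoid

    *#0⇒#0ˡ : ∀ {a b} → a * b # 0# → a # 0#
    *#0⇒#0ˡ ab#0 = *#0⇒#0ʳ (#-congʳ (*-comm _ _) ab#0)

    +#0-split : ∀ a {b} → b # 0# → (a + b # 0#) ⊎ (a # 0#)
    +#0-split a {b} b#0 with K.#-cotrans b#0 (a + b)
    ... | inj₂ a+b#0 = inj₁ a+b#0
    ... | inj₁ b#a+b with K.#⇒invertible (K.#-sym b#a+b)
    ... | u , u*a≈1 , _ = inj₂ (invertibleˡ⇒# (u , (begin
      u * (a + - 0#)        ≈⟨ *-congˡ (x-0≈x a) ⟩
      u * a                 ≈⟨ *-congˡ (+-identityʳ a) ⟨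
      u * (a + 0#)          ≈⟨ *-congˡ (+-congˡ (-‿inverseʳ b)) ⟨
      u * (a + (b + - b))   ≈⟨ *-congˡ (+-assoc a b (- b)) ⟨
      u * ((a + b) + - b)   ≈⟨ u*a≈1 ⟩
      1#                    ∎)))
      where open ≈-Reasoning setoid

    head#0-* : ∀ a p q → a # 0# → Nonzeroₚ q → Nonzeroₚ ((a ∷ p) *ₚ q)
    head#0-* a p []      a#0 q≢0 = ⊥-case (proj₂ q≢0)
      where
      ⊥-case : ∀ {A : Set ℓ₂} → 0# # 0# → A
      ⊥-case 0#0 with () ← K.#-irrefl refl 0#0
    head#0-* a p (b ∷ q) a#0 (zero  , b#0) =
      0 , #-congʳ (sym (coeff-*-zero a p (b ∷ q))) (x#0y#0→xy#0 a#0 b#0)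
    head#0-* a p (b ∷ q) a#0 (suc n , qₙ#0)
      with head#0-* a p q a#0 (n , qₙ#0)
    ... | k , r#0 with +#0-split (coeff (a ∷ p) (suc k) * b) r#0
    ...   | inj₁ s#0 = suc k , #-congʳ (sym (coeff-*-∷ (a ∷ p) b q k)) s#0
    ...   | inj₂ s#0 = head#0-* a p (b ∷ q) a#0 (zero , *#0⇒#0ʳ s#0)

  Nonzeroₚ-* : ∀ p q → Nonzeroₚ p → Nonzeroₚ q → Nonzeroₚ (p *ₚ q)
  Nonzeroₚ-* []      q (_ , 0#0) _ with () ← K.#-irrefl refl 0#0
  Nonzeroₚ-* (a ∷ p) q (zero  , a#0)  q≢0 = head#0-* a p q a#0 q≢0
  Nonzeroₚ-* (a ∷ p) q (suc n , pₙ#0) q≢0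
    with Nonzeroₚ-* p q (n , pₙ#0) q≢0
  ... | k , r#0 with +#0-split (a * coeff q (suc k)) r#0
  ...   | inj₁ s#0 = suc k , #-congʳ (sym (coeff-*-suc a p q k)) s#0
  ...   | inj₂ s#0 = head#0-* a p q (*#0⇒#0ˡ s#0) q≢0

  ----------------------------------------------------------------------
  -- K(x): the field of fractions of K[x]

  record K⟨x⟩ : Set (c ⊔ ℓ₂) where
    constructor _/_[_]
    field
      num   : K[x]
      den   : K[x]
      den≢0 : Nonzeroₚ den

  1≢0ₚ : Nonzeroₚ (1# ∷ [])
  1≢0ₚ = 0 , 1#0

  ι : K[x] → K⟨x⟩
  ι p = p / (1# ∷ []) [ 1≢0ₚ ]

  ratRing : RawRing (c ⊔ ℓ₂) ℓ₁
  ratRing = record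
    { Carrier = K⟨x⟩
    ; _≈_     = λ { (p / q [ _ ]) (p′ / q′ [ _ ]) → p *ₚ q′ ≈ₚ p′ *ₚ q }
    ; _+_     = λ { (p / q [ q≢0 ]) (p′ / q′ [ q′≢0 ]) →
                    (p *ₚ q′ +ₚ p′ *ₚ q) / (q *ₚ q′) [ Nonzeroₚ-* q q′ q≢0 q′≢0 ] }
    ; _*_     = λ { (p / q [ q≢0 ]) (p′ / q′ [ q′≢0 ]) →
                    (p *ₚ p′) / (q *ₚ q′) [ Nonzeroₚ-* q q′ q≢0 q′≢0 ] }
    ; -_      = λ { (p / q [ q≢0 ]) → map -_ p / q [ q≢0 ] }
    ; 0#      = ι []
    ; 1#      = ι (1# ∷ [])
    }
    where open RawRing polyRing using () renaming (_≈_ to _≈ₚ_)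

  inverseᵣ : (r : K⟨x⟩) → Nonzeroₚ (K⟨x⟩.num r) → K⟨x⟩
  inverseᵣ (p / q [ _ ]) p≢0 = q / p [ p≢0 ]

  ----------------------------------------------------------------------
  -- K⟦t⟧, K[x]⟦t⟧ and K(x)⟦t⟧

  module S₀ = Series rawRing
  module Sₚ = Series polyRing
  module Sᵣ = Series ratRing

  K⟦t⟧    = S₀.R⟦t⟧
  K[x]⟦t⟧ = Sₚ.R⟦t⟧
  K⟨x⟩⟦t⟧ = Sᵣ.R⟦t⟧

  infixl 7 _÷₀_[_] _÷_[_]

  _÷₀_[_] : K⟦t⟧ → (G : K⟦t⟧) → G 0 # 0# → K⟦t⟧
  F ÷₀ G [ G₀#0 ] = F S₀.⊛ S₀.reciprocal (inverse G₀#0) G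

  -- A quotient of series over K[x], formed in K(x)⟦t⟧.
  _÷_[_] : K[x]⟦t⟧ → (G : K[x]⟦t⟧) → Nonzeroₚ (G 0) → K⟨x⟩⟦t⟧
  F ÷ G [ G₀≢0 ] =
    (ι ∘ F) Sᵣ.⊛ Sᵣ.reciprocal (inverseᵣ (ι (G 0)) G₀≢0) (ι ∘ G)

  exp : K⟦t⟧
  exp n = 1/ n !

  expₚ : K[x]⟦t⟧ → K[x]⟦t⟧
  expₚ F = (C ∘ exp) Sₚ.⊚ F

  egf : (ℕ → K[x]) → K[x]⟦t⟧
  egf a n = a n *ₚ C (1/ n !)

  record IsCompositionalInverse (f f̄ : K⟦t⟧) : Set ℓ₁ where
    field
      f̄₀≈0  : f̄ 0 ≈ 0#
      f∘f̄≋t : f S₀.⊚ f̄ S₀.≋ S₀.t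
      f̄∘f≋t : f̄ S₀.⊚ f S₀.≋ S₀.t

  ⊚-const#0 : ∀ g h → g 0 # 0# → (g S₀.⊚ h) 0 # 0#
  ⊚-const#0 g h = #-congʳ (sym (trans (+-identityʳ _) (*-identityʳ _)))

  IsSheffer : (g f̄ : K⟦t⟧) → g 0 # 0# → (ℕ → K[x]) → Set ℓ₁
  IsSheffer g f̄ g₀#0 p =
    egf p Sₚ.≋
    (C ∘ (S₀.const 1# ÷₀ (g S₀.⊚ f̄) [ ⊚-const#0 g f̄ g₀#0 ]))
      Sₚ.⊛ expₚ (x Sₚ.· (C ∘ f̄))

  ----------------------------------------------------------------------
  -- Eulerian numbers

  module P = RawRing polyRing
  open RawSemiringDefinitions P.rawSemiring
    using () renaming (sum to sumₚ; product to productₚ; _^_ to _^ₚ_; _×_ to _×ₚ_)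

  fromℕ : ℕ → K[x]
  fromℕ n = n ×ₚ P.1#

  infixl 6 _-ₚ_
  _-ₚ_ : K[x] → K[x] → K[x]
  p -ₚ q = p +ₚ P.- q

  binomial : K[x] → ℕ → K[x]
  binomial y n = productₚ {n} (λ i → y -ₚ fromℕ (toℕ i)) *ₚ C (1/ n !)

  IsEulerian : (ℕ → K[x]) → ((n : ℕ) → Fin (suc n) → Carrier) → Set ℓ₁
  IsEulerian p A = ∀ n →
    p n P.≈ sumₚ {suc n} λ k →
      C (A n k) *ₚ binomial (x +ₚ fromℕ n -ₚ fromℕ (toℕ k) -ₚ fromℕ 1) n

  eulerianPolynomial : ((n : ℕ) → Fin (suc n) → Carrier) → ℕ → K[x]
  eulerianPolynomial A n = sumₚ {suc n} λ k → C (A n k) *ₚ x ^ₚ toℕ k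

  ----------------------------------------------------------------------
  -- Series in (1 - x) t

  1-x : K[x]
  1-x = P.1# -ₚ x

  -- h((1 - x) t)
  _[1-x]t : K⟦t⟧ → K[x]⟦t⟧
  h [1-x]t = (C ∘ h) Sₚ.⟨ 1-x t⟩

  ⊚ₚ-const≢0 : ∀ g (H : K[x]⟦t⟧) → g 0 # 0# → Nonzeroₚ (((C ∘ g) Sₚ.⊚ H) 0)
  ⊚ₚ-const≢0 g H g₀#0 =
    0 , #-congʳ (sym (trans (+-identityʳ _) (*-identityʳ _))) g₀#0

  1-x·exp-const≢0 : ∀ (H : K[x]⟦t⟧) →
    Nonzeroₚ ((Sₚ.const P.1# Sₚ.⊖ x Sₚ.· expₚ H) 0)
  1-x·exp-const≢0 H = 0 , #-congʳ (sym 1-0≈1) 1#0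
    where
    1-0≈1 : ∀ {b} → 1# + - (0# * b + 0#) ≈ 1#
    1-0≈1 {b} = trans
      (+-congˡ (trans (-‿cong (trans (+-identityʳ _) (zeroˡ b))) -0#≈0#))
      (+-identityʳ 1#)

-- Evaluating at x = m + 1 gives, for each n, the expansion
--   A_n(x) / (1 - x)ⁿ⁺¹ = Σ_m p_n(m + 1) xᵐ   in K⟦x⟧,
-- since (1 - x)ⁿ⁺¹ Σ_m binom(m + n - k, n) xᵐ = xᵏ for k ≤ n.  Put γ = g ∘ f̄
-- and e = exp ∘ f̄.  The Sheffer property at x = m + 1 says that
--   γ · Σ_n p_n(m + 1) tⁿ/n! = eᵐ⁺¹,
-- so summing a geometric series in x e yields
--   (Σ_n A_n(x) / (1 - x)ⁿ⁺¹ tⁿ/n!) · γ · (1 - x e) = e   in K⟦x⟧⟦t⟧.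
-- Replacing t by (1 - x) t and multiplying by 1 - x turns this into an identity
-- of series over K[x], which embeds in K⟦x⟧; dividing over K(x) is then harmless.

module Submission where

open import Defs
open import Algebra.Apartness.Bundles using (HeytingField)
open import Algebra.Bundles using (CommutativeRing; RawRing)
open import Algebra.Morphism.Structures using (IsRingHomomorphism; IsRingMonomorphism)
open import Algebra.Structures using (IsCommutativeRing)
open import Data.Fin.Base using (Fin; toℕ) renaming (zero to fzero; suc to fsuc)
open import Data.List.Base using ([]; _∷_; map)
open import Data.Nat.Base as ℕ using (ℕ; zero; suc; _∸_; _≤_; _<_; z≤n; s≤s; _!)
open import Data.Nat.Combinatorics
  using ( nCk≡n!/k![n-k]!; k![n∸k]!∣n!; nCk+nC[k+1]≡[n+1]C[k+1]; k>n⇒nCk≡0; nCn≡1 )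
  renaming (_C_ to _choose_)
open import Data.Nat.DivMod using (m/n*n≡m)
open import Data.Product.Base using (_,_; proj₁; proj₂)
open import Data.Vec.Base using (lookup)
open import Function.Base using (_∘_)
open import Relation.Binary.PropositionalEquality as ≡ using (_≡_; module ≡-Reasoning)
open import Relation.Nullary.Decidable.Core using (yes; no)
import Algebra.Apartness.Properties.HeytingCommutativeRing as HeytingProperties
import Algebra.Definitions.RawSemiring as RawSemiringDefinitions
import Algebra.Morphism.RingMonomorphism as RingMonomorphism
import Algebra.Properties.CommutativeMonoid.Sum as MonoidSum
import Algebra.Properties.CommutativeSemigroup as CommutativeSemigroupProperties
import Algebra.Properties.CommutativeSemiring.Binomial as BinomialTheorem
import Algebra.Properties.Ring as RingProperties
import Algebra.Properties.Semiring.Mult as SemiringMult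
import Algebra.Properties.Semiring.Sum as SemiringSum
import Algebra.Solver.Ring.NaturalCoefficients.Default as SemiringSolver
import Data.Fin.Properties as Fin
import Data.Nat.Properties as ℕ
import Relation.Binary.Reasoning.Setoid as ≈-Reasoning

-- The values are taken at m + 1 because x + n - k - 1 is then the natural number m + (n ∸ k), so
-- that every value is an ordinary binomial coefficient obeying Pascal's rule. At x = 0 and k = n
-- the upper argument would be -1, where the binomial does not vanish.
--
-- The obstacle is that two different rings are involved. Summing over m takes place over K⟦x⟧, the
-- quotient of the theorem is formed over K(x), and neither of these contains the other. What they
-- share is K[x], so only an identity without quotients can pass from one to the other. Equality in
-- `K[x]` is coefficientwise by definition, so `coeff` reflects such an identity from K⟦x⟧
-- immediately.
--
-- The two hypotheses on p also live in different directions of one array of values p_n(m + 1): the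
-- Eulerian expansion concerns all m for a fixed n, the Sheffer property all n for a fixed m.

-- The ring of formal power series.

module SeriesProperties {c ℓ} (R : CommutativeRing c ℓ) where

  open CommutativeRing R hiding (rawRing)
  open Series (CommutativeRing.rawRing R) public
  open MonoidSum +-commutativeMonoid
    using (sum; sum-cong-≋; ∑-distrib-+; sum-replicate-zero)
  open SemiringSum semiring using (*-distribˡ-sum)
  open CommutativeSemigroupProperties +-commutativeSemigroup
    using (x∙yz≈y∙xz)
  open RingProperties ring using (-‿distribʳ-*)
  open ≈-Reasoning setoid

  ⊛-cong : ∀ {F F′ G G′} → F ≋ F′ → G ≋ G′ → F ⊛ G ≋ F′ ⊛ G′
  ⊛-cong F≋F′ G≋G′ n =
    sum-cong-≋ {suc n} λ k → *-cong (F≋F′ (toℕ k)) (G≋G′ (n ∸ toℕ k))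

  ⊛-distribʳ : ∀ H F G → (F ⊕ G) ⊛ H ≋ F ⊛ H ⊕ G ⊛ H
  ⊛-distribʳ H F G n = trans
    (sum-cong-≋ {suc n} λ k → distribʳ (H (n ∸ toℕ k)) (F (toℕ k)) (G (toℕ k)))
    (∑-distrib-+ {suc n} (λ k → F (toℕ k) * H (n ∸ toℕ k)) (λ k → G (toℕ k) * H (n ∸ toℕ k)))

  ·-⊛ : ∀ a F G → (a · F) ⊛ G ≋ a · (F ⊛ G)
  ·-⊛ a F G n = trans
    (sum-cong-≋ {suc n} λ k → *-assoc a (F (toℕ k)) (G (n ∸ toℕ k)))
    (sym (*-distribˡ-sum {suc n} a λ k → F (toℕ k) * G (n ∸ toℕ k)))

  0-⊛ : ∀ G → (λ _ → 0#) ⊛ G ≋ λ _ → 0#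
  0-⊛ G n = trans
    (sum-cong-≋ {suc n} {λ k → 0# * G (n ∸ toℕ k)} {λ _ → 0#} λ k → zeroˡ (G (n ∸ toℕ k)))
    (sum-replicate-zero (suc n))

  const-⊛ : ∀ a G → const a ⊛ G ≋ a · G
  const-⊛ a G zero    = +-identityʳ _
  const-⊛ a G (suc n) = trans (+-congˡ (0-⊛ G n)) (+-identityʳ _)

  -- The sum defining `_⊛_` unfolds at its first term and shifts `F`. Peeling off the last term
  -- shifts `G` instead, and comparing the two gives commutativity by induction.
  ⊛-suc : ∀ F G n → (F ⊛ G) (suc n) ≈ F (suc n) * G 0 + (F ⊛ (G ∘ suc)) n
  ⊛-suc F G zero = begin
    F 0 * G 1 + (F 1 * G 0 + 0#)   ≈⟨ x∙yz≈y∙xz _ _ _ ⟩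
    F 1 * G 0 + (F 0 * G 1 + 0#)   ∎
  ⊛-suc F G (suc n) = begin
    F 0 * G (suc (suc n)) + ((F ∘ suc) ⊛ G) (suc n)
      ≈⟨ +-congˡ (⊛-suc (F ∘ suc) G n) ⟩
    F 0 * G (suc (suc n)) + (F (suc (suc n)) * G 0 + ((F ∘ suc) ⊛ (G ∘ suc)) n)
      ≈⟨ x∙yz≈y∙xz _ _ _ ⟩
    F (suc (suc n)) * G 0 + (F ⊛ (G ∘ suc)) (suc n) ∎

  ⊛-comm : ∀ F G → F ⊛ G ≋ G ⊛ F
  ⊛-comm F G zero    = +-congʳ (*-comm _ _)
  ⊛-comm F G (suc n) = begin
    F 0 * G (suc n) + ((F ∘ suc) ⊛ G) n   ≈⟨ +-cong (*-comm _ _) (⊛-comm (F ∘ suc) G n) ⟩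
    G (suc n) * F 0 + (G ⊛ (F ∘ suc)) n   ≈⟨ ⊛-suc G F n ⟨
    (G ⊛ F) (suc n)                       ∎

  -- The shift of `F ⊛ G` is, by unfolding, `F 0 · (G ∘ suc) ⊕ (F ∘ suc) ⊛ G`. Induction on the
  -- coefficient with `F` shifted therefore avoids reindexing a double sum.
  ⊛-assoc : ∀ F G H → (F ⊛ G) ⊛ H ≋ F ⊛ (G ⊛ H)
  ⊛-assoc F G H zero = begin
    (F 0 * G 0 + 0#) * H 0 + 0#   ≈⟨ +-congʳ (*-congʳ (+-identityʳ _)) ⟩
    F 0 * G 0 * H 0 + 0#          ≈⟨ +-congʳ (*-assoc _ _ _) ⟩
    F 0 * (G 0 * H 0) + 0#        ≈⟨ +-congʳ (*-congˡ (+-identityʳ _)) ⟨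
    F 0 * (G 0 * H 0 + 0#) + 0#   ∎
  ⊛-assoc F G H (suc n) = begin
    (F 0 * G 0 + 0#) * H (suc n) + ((F 0 · (G ∘ suc) ⊕ (F ∘ suc) ⊛ G) ⊛ H) n
      ≈⟨ +-cong (trans (*-congʳ (+-identityʳ _)) (*-assoc _ _ _))
                (⊛-distribʳ H (F 0 · (G ∘ suc)) ((F ∘ suc) ⊛ G) n) ⟩
    F 0 * (G 0 * H (suc n)) + (((F 0 · (G ∘ suc)) ⊛ H) n + (((F ∘ suc) ⊛ G) ⊛ H) n)
      ≈⟨ +-congˡ (+-cong (·-⊛ (F 0) (G ∘ suc) H n) (⊛-assoc (F ∘ suc) G H n)) ⟩
    F 0 * (G 0 * H (suc n)) + (F 0 * ((G ∘ suc) ⊛ H) n + ((F ∘ suc) ⊛ (G ⊛ H)) n)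
      ≈⟨ +-assoc _ _ _ ⟨
    F 0 * (G 0 * H (suc n)) + F 0 * ((G ∘ suc) ⊛ H) n + ((F ∘ suc) ⊛ (G ⊛ H)) n
      ≈⟨ +-congʳ (distribˡ _ _ _) ⟨
    F 0 * (G 0 * H (suc n) + ((G ∘ suc) ⊛ H) n) + ((F ∘ suc) ⊛ (G ⊛ H)) n ∎

  ⊛-identityˡ : ∀ F → const 1# ⊛ F ≋ F
  ⊛-identityˡ F n = trans (const-⊛ 1# F n) (*-identityˡ _)

  const0≈0 : ∀ n → const 0# n ≈ 0#
  const0≈0 zero    = refl
  const0≈0 (suc n) = refl

  ⊛-distribˡ : ∀ H F G → H ⊛ (F ⊕ G) ≋ H ⊛ F ⊕ H ⊛ G
  ⊛-distribˡ H F G n = begin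
    (H ⊛ (F ⊕ G)) n             ≈⟨ ⊛-comm H (F ⊕ G) n ⟩
    ((F ⊕ G) ⊛ H) n             ≈⟨ ⊛-distribʳ H F G n ⟩
    (F ⊛ H) n + (G ⊛ H) n       ≈⟨ +-cong (⊛-comm F H n) (⊛-comm G H n) ⟩
    (H ⊛ F) n + (H ⊛ G) n       ∎

  ⊛-isCommutativeRing : IsCommutativeRing _≋_ _⊕_ _⊛_ (λ F n → - F n) (const 0#) (const 1#)
  ⊛-isCommutativeRing = record
    { isRing = record
      { +-isAbelianGroup = record
        { isGroup = record
          { isMonoid = record
            { isSemigroup = record
              { isMagma = record
                { isEquivalence = record
                  { refl  = λ n → refl
                  ; sym   = λ p n → sym (p n)
                  ; trans = λ p q n → trans (p n) (q n)
                  }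
                ; ∙-cong = λ p q n → +-cong (p n) (q n)
                }
              ; assoc = λ F G H n → +-assoc (F n) (G n) (H n)
              }
            ; identity = (λ F n → trans (+-congʳ (const0≈0 n)) (+-identityˡ (F n)))
                       , (λ F n → trans (+-congˡ (const0≈0 n)) (+-identityʳ (F n)))
            }
          ; inverse = (λ F n → trans (-‿inverseˡ (F n)) (sym (const0≈0 n)))
                    , (λ F n → trans (-‿inverseʳ (F n)) (sym (const0≈0 n)))
          ; ⁻¹-cong = λ p n → -‿cong (p n)
          }
        ; comm = λ F G n → +-comm (F n) (G n)
        }
      ; *-cong     = ⊛-cong
      ; *-assoc    = ⊛-assoc
      ; *-identity = ⊛-identityˡ
                   , λ F n → trans (⊛-comm F (const 1#) n) (⊛-identityˡ F n)
      ; distrib    = ⊛-distribˡ , ⊛-distribʳ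
      }
    ; *-comm = ⊛-comm
    }

  seriesRing : CommutativeRing c ℓ
  seriesRing = record { isCommutativeRing = ⊛-isCommutativeRing }

  module S = CommutativeRing seriesRing

  ·-cong : ∀ {a b F G} → a ≈ b → F ≋ G → a · F ≋ b · G
  ·-cong a≈b F≋G n = *-cong a≈b (F≋G n)

  module _ (u : Carrier) (F : R⟦t⟧) (F₀u≈1 : F 0 * u ≈ 1#) where

    private
      H = reciprocal u F

      -- The vector lists the newest coefficient first. Its entries thus appear in the order in
      -- which a Cauchy product pairs them with the coefficients of `F`.
      lookup-reciprocalUpTo : ∀ n (k : Fin (suc n)) →
        lookup (reciprocalUpTo u F n) k ≈ H (n ∸ toℕ k)
      lookup-reciprocalUpTo zero    fzero    = refl
      lookup-reciprocalUpTo (suc n) fzero    = refl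
      lookup-reciprocalUpTo (suc n) (fsuc k) = lookup-reciprocalUpTo n k

    ⊛-reciprocal : F ⊛ reciprocal u F ≋ const 1#
    ⊛-reciprocal zero    = trans (+-identityʳ _) F₀u≈1
    ⊛-reciprocal (suc n) = begin
      F 0 * - (u * s) + ((F ∘ suc) ⊛ H) n   ≈⟨ +-congˡ s≈ ⟨
      F 0 * - (u * s) + s                   ≈⟨ +-congʳ (-‿distribʳ-* _ _) ⟨
      - (F 0 * (u * s)) + s                 ≈⟨ +-congʳ (-‿cong (*-assoc _ _ _)) ⟨
      - (F 0 * u * s) + s                   ≈⟨ +-congʳ (-‿cong (*-congʳ F₀u≈1)) ⟩
      - (1# * s) + s                        ≈⟨ +-congʳ (-‿cong (*-identityˡ s)) ⟩
      - s + s                               ≈⟨ -‿inverseˡ s ⟩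
      0#                                    ∎
      where
      s = sum {suc n} λ k → F (suc (toℕ k)) * lookup (reciprocalUpTo u F n) k
      s≈ : s ≈ ((F ∘ suc) ⊛ H) n
      s≈ = sum-cong-≋ {suc n} λ k → *-congˡ {F (suc (toℕ k))} (lookup-reciprocalUpTo n k)

-- Composition and dilation of power series.

module CompositionProperties {c ℓ} (R : CommutativeRing c ℓ) where

  open CommutativeRing R hiding (rawRing)
  open SeriesProperties R
  open RawSemiringDefinitions (RawRing.rawSemiring (CommutativeRing.rawRing R))
    using (_^_)
  open MonoidSum +-commutativeMonoid
    using (sum; sum-cong-≋; ∑-distrib-+; sum-replicate-zero)
  open SemiringSum semiring using (*-distribˡ-sum; *-distribʳ-sum)
  open CommutativeSemigroupProperties *-commutativeSemigroup
    using (x∙yz≈y∙xz)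
  open ≈-Reasoning setoid

  ^ˢ-cong : ∀ {F G} → F ≋ G → ∀ k → F ^ˢ k ≋ G ^ˢ k
  ^ˢ-cong F≋G zero    = S.refl
  ^ˢ-cong F≋G (suc k) = ⊛-cong F≋G (^ˢ-cong F≋G k)

  ⊚-cong : ∀ {F F′ G G′} → F ≋ F′ → G ≋ G′ → F ⊚ G ≋ F′ ⊚ G′
  ⊚-cong F≋F′ G≋G′ n =
    sum-cong-≋ {suc n} λ k → *-cong (F≋F′ (toℕ k)) (^ˢ-cong G≋G′ (toℕ k) n)

  ⊕-⊚ : ∀ P Q G → (P ⊕ Q) ⊚ G ≋ P ⊚ G ⊕ Q ⊚ G
  ⊕-⊚ P Q G n = trans
    (sum-cong-≋ {suc n} λ k → distribʳ ((G ^ˢ toℕ k) n) (P (toℕ k)) (Q (toℕ k)))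
    (∑-distrib-+ {suc n} (λ k → P (toℕ k) * (G ^ˢ toℕ k) n) (λ k → Q (toℕ k) * (G ^ˢ toℕ k) n))

  ·-⊚ : ∀ a P G → (a · P) ⊚ G ≋ a · (P ⊚ G)
  ·-⊚ a P G n = trans
    (sum-cong-≋ {suc n} λ k → *-assoc a (P (toℕ k)) ((G ^ˢ toℕ k) n))
    (sym (*-distribˡ-sum {suc n} a λ k → P (toℕ k) * (G ^ˢ toℕ k) n))

  ⊛-· : ∀ a F G → F ⊛ (a · G) ≋ a · (F ⊛ G)
  ⊛-· a F G n = begin
    (F ⊛ (a · G)) n   ≈⟨ ⊛-comm F (a · G) n ⟩
    ((a · G) ⊛ F) n   ≈⟨ ·-⊛ a G F n ⟩
    a * (G ⊛ F) n     ≈⟨ *-congˡ (⊛-comm G F n) ⟩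
    a * (F ⊛ G) n     ∎

  ⊛-cong-≤ : ∀ F {X Y} n → (∀ j → j ≤ n → X j ≈ Y j) → (F ⊛ X) n ≈ (F ⊛ Y) n
  ⊛-cong-≤ F n X≈Y = sum-cong-≋ {suc n} λ k →
    *-congˡ {F (toℕ k)} (X≈Y (n ∸ toℕ k) (ℕ.m∸n≤m n (toℕ k)))

  ⊛-0 : ∀ F → F ⊛ (λ _ → 0#) ≋ λ _ → 0#
  ⊛-0 F n = trans (⊛-comm F (λ _ → 0#) n) (0-⊛ F n)

  ⊛-sum : ∀ F N (a : Fin N → Carrier) (Y : Fin N → R⟦t⟧) n →
    (F ⊛ (λ i → sum λ k → a k * Y k i)) n ≈ sum λ k → a k * (F ⊛ Y k) n
  ⊛-sum F zero    a Y n = ⊛-0 F n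
  ⊛-sum F (suc N) a Y n = trans
    (⊛-distribˡ F (a fzero · Y fzero) (λ i → sum λ k → a (fsuc k) * Y (fsuc k) i) n)
    (+-cong (⊛-· (a fzero) F (Y fzero) n) (⊛-sum F N (a ∘ fsuc) (Y ∘ fsuc) n))

  sum-truncate : ∀ (f : ℕ → Carrier) {n N} → n ≤ N → (∀ k → n ≤ k → f k ≈ 0#) →
    sum {N} (f ∘ toℕ) ≈ sum {n} (f ∘ toℕ)
  sum-truncate f {N = N} z≤n f≈0 = trans
    (sum-cong-≋ {N} {f ∘ toℕ} {λ _ → 0#} λ k → f≈0 (toℕ k) z≤n)
    (sum-replicate-zero N)
  sum-truncate f (s≤s n≤N) f≈0 =
    +-congˡ (sum-truncate (f ∘ suc) n≤N λ k n≤k → f≈0 (suc k) (s≤s n≤k))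

  module _ (G : R⟦t⟧) (G₀≈0 : G 0 ≈ 0#) where

    ⊛-suc-0 : ∀ X n → (G ⊛ X) (suc n) ≈ ((G ∘ suc) ⊛ X) n
    ⊛-suc-0 X n = trans (+-congʳ (trans (*-congʳ G₀≈0) (zeroˡ _))) (+-identityˡ _)

    ⊛-zero-0 : ∀ X → (G ⊛ X) 0 ≈ 0#
    ⊛-zero-0 X = trans (+-identityʳ _) (trans (*-congʳ G₀≈0) (zeroˡ _))

    -- The top coefficient `X n` enters only multiplied by `G 0`, which is zero. This strict gain of
    -- one degree drives the inductions below.
    ⊛-cong-< : ∀ {X Y} n → (∀ j → j < n → X j ≈ Y j) → (G ⊛ X) n ≈ (G ⊛ Y) n
    ⊛-cong-< {X} {Y} zero    X≈Y = trans (⊛-zero-0 X) (sym (⊛-zero-0 Y))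
    ⊛-cong-< {X} {Y} (suc n) X≈Y = begin
      (G ⊛ X) (suc n)       ≈⟨ ⊛-suc-0 X n ⟩
      ((G ∘ suc) ⊛ X) n     ≈⟨ ⊛-cong-≤ (G ∘ suc) n (λ j j≤n → X≈Y j (s≤s j≤n)) ⟩
      ((G ∘ suc) ⊛ Y) n     ≈⟨ ⊛-suc-0 Y n ⟨
      (G ⊛ Y) (suc n)       ∎

    ^ˢ-vanish : ∀ k n → n < k → (G ^ˢ k) n ≈ 0#
    ^ˢ-vanish (suc k) n (s≤s n≤k) = trans
      (⊛-cong-< n λ j j<n → ^ˢ-vanish k j (ℕ.≤-trans j<n n≤k))
      (⊛-0 G n)

    -- The bound in `_⊚_` varies with the coefficient. Since Gᵏ has no terms below tᵏ, one larger
    -- bound can serve several coefficients at once, as a product with a composite requires.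
    ⊚-truncate : ∀ P {n N} → n < N → (P ⊚ G) n ≈ sum {N} λ k → P (toℕ k) * (G ^ˢ toℕ k) n
    ⊚-truncate P {n} n<N = sym (sum-truncate (λ k → P k * (G ^ˢ k) n) n<N
      λ k n<k → trans (*-congˡ (^ˢ-vanish k n n<k)) (zeroʳ _))

    -- Trades the sum over powers of `G` for a recursion on `P`, the form in which multiplicativity
    -- of composition can be proved by induction.
    ⊚-horner : ∀ P → P ⊚ G ≋ const (P 0) ⊕ G ⊛ ((P ∘ suc) ⊚ G)
    ⊚-horner P zero = +-cong (*-identityʳ _) (sym (⊛-zero-0 ((P ∘ suc) ⊚ G)))
    ⊚-horner P (suc n) = +-cong (zeroʳ _) (begin
      sum {suc n} (λ k → P (suc (toℕ k)) * (G ⊛ (G ^ˢ toℕ k)) (suc n))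
        ≈⟨ sum-cong-≋ {suc n} (λ k → *-congˡ {P (suc (toℕ k))} (⊛-suc-0 (G ^ˢ toℕ k) n)) ⟩
      sum {suc n} (λ k → P (suc (toℕ k)) * ((G ∘ suc) ⊛ (G ^ˢ toℕ k)) n)
        ≈⟨ ⊛-sum (G ∘ suc) (suc n) (λ k → P (suc (toℕ k))) (λ k → G ^ˢ toℕ k) n ⟨
      ((G ∘ suc) ⊛ (λ i → sum {suc n} λ k → P (suc (toℕ k)) * (G ^ˢ toℕ k) i)) n
        ≈⟨ ⊛-cong-≤ (G ∘ suc) n (λ j j≤n → ⊚-truncate (P ∘ suc) (s≤s j≤n)) ⟨
      ((G ∘ suc) ⊛ ((P ∘ suc) ⊚ G)) n
        ≈⟨ ⊛-suc-0 ((P ∘ suc) ⊚ G) n ⟨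
      (G ⊛ ((P ∘ suc) ⊚ G)) (suc n) ∎)

    private
      const-* : ∀ a b → const (a * b) ≋ a · const b
      const-* a b zero    = refl
      const-* a b (suc n) = sym (zeroʳ a)

    -- Split off P 0 by Horner's rule.  As G 0 ≈ 0, the n-th coefficient of G ⊛ X
    -- involves only lower coefficients of X, which is what the induction needs.
    ⊛-⊚-< : ∀ Q N P n → n < N → ((P ⊛ Q) ⊚ G) n ≈ ((P ⊚ G) ⊛ (Q ⊚ G)) n
    ⊛-⊚-< Q (suc N) P n (s≤s n≤N) = begin
      ((P ⊛ Q) ⊚ G) n
        ≈⟨ ⊚-horner (P ⊛ Q) n ⟩
      const (P 0 * Q 0 + 0#) n + (G ⊛ ((P 0 · (Q ∘ suc) ⊕ (P ∘ suc) ⊛ Q) ⊚ G)) n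
        ≈⟨ +-cong (const-cong (+-identityʳ (P 0 * Q 0)) n)
                  (⊛-cong (S.refl {G}) (⊕-⊚ (P 0 · (Q ∘ suc)) ((P ∘ suc) ⊛ Q) G) n) ⟩
      const (P 0 * Q 0) n + (G ⊛ ((P 0 · (Q ∘ suc)) ⊚ G ⊕ ((P ∘ suc) ⊛ Q) ⊚ G)) n
        ≈⟨ +-cong (const-* (P 0) (Q 0) n)
             (⊛-distribˡ G ((P 0 · (Q ∘ suc)) ⊚ G) (((P ∘ suc) ⊛ Q) ⊚ G) n) ⟩
      P 0 * const (Q 0) n + ((G ⊛ ((P 0 · (Q ∘ suc)) ⊚ G)) n + (G ⊛ (((P ∘ suc) ⊛ Q) ⊚ G)) n)
        ≈⟨ +-congˡ (+-cong
             (trans (⊛-cong (S.refl {G}) (·-⊚ (P 0) (Q ∘ suc) G) n)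
                    (⊛-· (P 0) G ((Q ∘ suc) ⊚ G) n))
             (⊛-cong-< n λ j j<n → ⊛-⊚-< Q N (P ∘ suc) j (ℕ.≤-trans j<n n≤N))) ⟩
      P 0 * const (Q 0) n + (P 0 * (G ⊛ ((Q ∘ suc) ⊚ G)) n + (G ⊛ (((P ∘ suc) ⊚ G) ⊛ (Q ⊚ G))) n)
        ≈⟨ +-assoc _ _ _ ⟨
      P 0 * const (Q 0) n + P 0 * (G ⊛ ((Q ∘ suc) ⊚ G)) n + (G ⊛ (((P ∘ suc) ⊚ G) ⊛ (Q ⊚ G))) n
        ≈⟨ +-congʳ (distribˡ _ _ _) ⟨
      P 0 * (const (Q 0) n + (G ⊛ ((Q ∘ suc) ⊚ G)) n) + (G ⊛ (((P ∘ suc) ⊚ G) ⊛ (Q ⊚ G))) n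
        ≈⟨ +-cong (trans (const-⊛ (P 0) (Q ⊚ G) n) (*-congˡ (⊚-horner Q n)))
                  (⊛-assoc G ((P ∘ suc) ⊚ G) (Q ⊚ G) n) ⟨
      (const (P 0) ⊛ (Q ⊚ G)) n + ((G ⊛ ((P ∘ suc) ⊚ G)) ⊛ (Q ⊚ G)) n
        ≈⟨ ⊛-distribʳ (Q ⊚ G) (const (P 0)) (G ⊛ ((P ∘ suc) ⊚ G)) n ⟨
      ((const (P 0) ⊕ G ⊛ ((P ∘ suc) ⊚ G)) ⊛ (Q ⊚ G)) n
        ≈⟨ ⊛-cong (⊚-horner P) (S.refl {Q ⊚ G}) n ⟨
      ((P ⊚ G) ⊛ (Q ⊚ G)) n ∎
      where
      const-cong : ∀ {a b} → a ≈ b → const a ≋ const b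
      const-cong a≈b zero    = a≈b
      const-cong a≈b (suc n) = refl

    ⊛-⊚ : ∀ P Q → (P ⊛ Q) ⊚ G ≋ (P ⊚ G) ⊛ (Q ⊚ G)
    ⊛-⊚ P Q n = ⊛-⊚-< Q (suc n) P n ℕ.≤-refl

  ⟨t⟩-cong : ∀ {F G} a → F ≋ G → F ⟨ a t⟩ ≋ G ⟨ a t⟩
  ⟨t⟩-cong a F≋G n = *-congʳ (F≋G n)

  ⟨t⟩-suc : ∀ F a → (F ⟨ a t⟩) ∘ suc ≋ a · ((F ∘ suc) ⟨ a t⟩)
  ⟨t⟩-suc F a n = x∙yz≈y∙xz _ _ _

  ⟨t⟩-⊛ : ∀ a F G → (F ⊛ G) ⟨ a t⟩ ≋ F ⟨ a t⟩ ⊛ G ⟨ a t⟩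
  ⟨t⟩-⊛ a F G zero = begin
    (F 0 * G 0 + 0#) * 1#         ≈⟨ *-identityʳ _ ⟩
    F 0 * G 0 + 0#                ≈⟨ +-congʳ (*-cong (*-identityʳ _) (*-identityʳ _)) ⟨
    F 0 * 1# * (G 0 * 1#) + 0#    ∎
  ⟨t⟩-⊛ a F G (suc n) = begin
    (F 0 * G (suc n) + ((F ∘ suc) ⊛ G) n) * (a * a ^ n)
      ≈⟨ distribʳ _ _ _ ⟩
    F 0 * G (suc n) * (a * a ^ n) + ((F ∘ suc) ⊛ G) n * (a * a ^ n)
      ≈⟨ +-cong (trans (*-assoc _ _ _) (*-congʳ (sym (*-identityʳ _)))) (x∙yz≈y∙xz _ _ _) ⟩
    F 0 * 1# * (G (suc n) * (a * a ^ n)) + a * (((F ∘ suc) ⊛ G) n * a ^ n)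
      ≈⟨ +-congˡ (*-congˡ (⟨t⟩-⊛ a (F ∘ suc) G n)) ⟩
    F 0 * 1# * (G (suc n) * (a * a ^ n)) + a * ((F ∘ suc) ⟨ a t⟩ ⊛ G ⟨ a t⟩) n
      ≈⟨ +-congˡ (·-⊛ a ((F ∘ suc) ⟨ a t⟩) (G ⟨ a t⟩) n) ⟨
    F 0 * 1# * (G (suc n) * (a * a ^ n)) + ((a · (F ∘ suc) ⟨ a t⟩) ⊛ G ⟨ a t⟩) n
      ≈⟨ +-congˡ (⊛-cong (⟨t⟩-suc F a) (S.refl {G ⟨ a t⟩}) n) ⟨
    F 0 * 1# * (G (suc n) * (a * a ^ n)) + (((F ⟨ a t⟩) ∘ suc) ⊛ G ⟨ a t⟩) n ∎

  ⟨t⟩-const : ∀ a b → const b ⟨ a t⟩ ≋ const b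
  ⟨t⟩-const a b zero    = *-identityʳ b
  ⟨t⟩-const a b (suc n) = zeroˡ _

  ⟨t⟩-^ˢ : ∀ a G k → (G ^ˢ k) ⟨ a t⟩ ≋ (G ⟨ a t⟩) ^ˢ k
  ⟨t⟩-^ˢ a G zero    = ⟨t⟩-const a 1#
  ⟨t⟩-^ˢ a G (suc k) n = trans (⟨t⟩-⊛ a G (G ^ˢ k) n)
    (⊛-cong (S.refl {G ⟨ a t⟩}) (⟨t⟩-^ˢ a G k) n)

  ⟨t⟩-⊚ : ∀ a P G → (P ⊚ G) ⟨ a t⟩ ≋ P ⊚ (G ⟨ a t⟩)
  ⟨t⟩-⊚ a P G n = trans
    (*-distribʳ-sum {suc n} (a ^ n) λ k → P (toℕ k) * (G ^ˢ toℕ k) n)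
    (sum-cong-≋ {suc n} λ k →
      trans (*-assoc (P (toℕ k)) _ _) (*-congˡ {P (toℕ k)} (⟨t⟩-^ˢ a G (toℕ k) n)))

  ·-^ˢ : ∀ a G k → (a · G) ^ˢ k ≋ a ^ k · (G ^ˢ k)
  ·-^ˢ a G zero    n = sym (*-identityˡ _)
  ·-^ˢ a G (suc k) n = begin
    ((a · G) ⊛ (a · G) ^ˢ k) n      ≈⟨ ⊛-cong (S.refl {a · G}) (·-^ˢ a G k) n ⟩
    ((a · G) ⊛ (a ^ k · G ^ˢ k)) n  ≈⟨ ·-⊛ a G (a ^ k · G ^ˢ k) n ⟩
    a * (G ⊛ (a ^ k · G ^ˢ k)) n    ≈⟨ *-congˡ (⊛-· (a ^ k) G (G ^ˢ k) n) ⟩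
    a * (a ^ k * (G ⊛ G ^ˢ k) n)    ≈⟨ *-assoc _ _ _ ⟨
    a * a ^ k * (G ⊛ G ^ˢ k) n      ∎

  -- Because (a G)ᵏ = aᵏ Gᵏ, a scalar on the inner series becomes a dilation of the outer one.
  -- Composites with different multiples of `G` thereby get the same inner series, so that `⊛-⊚`
  -- applies to them.
  ⊚-· : ∀ a P G → P ⊚ (a · G) ≋ P ⟨ a t⟩ ⊚ G
  ⊚-· a P G n = sum-cong-≋ {suc n} λ k →
    trans (*-congˡ {P (toℕ k)} (·-^ˢ a G (toℕ k) n)) (sym (*-assoc (P (toℕ k)) _ _))

-- Ring homomorphisms applied coefficientwise to series.

module SeriesHomomorphism {c₁ ℓ₁ c₂ ℓ₂} (A : CommutativeRing c₁ ℓ₁) (B : CommutativeRing c₂ ℓ₂)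
  (h : CommutativeRing.Carrier A → CommutativeRing.Carrier B)
  (isHom : IsRingHomomorphism (CommutativeRing.rawRing A) (CommutativeRing.rawRing B) h) where

  private
    module A = CommutativeRing A
    module B = CommutativeRing B
    module SA = SeriesProperties A
    module SB = SeriesProperties B
    open RawSemiringDefinitions (RawRing.rawSemiring A.rawRing)
      using () renaming (sum to sumᴬ; _^_ to _^ᴬ_)
    open RawSemiringDefinitions (RawRing.rawSemiring B.rawRing)
      using () renaming (sum to sumᴮ; _^_ to _^ᴮ_)
    open MonoidSum B.+-commutativeMonoid using (sum-cong-≋)

  open IsRingHomomorphism isHom
  open ≈-Reasoning B.setoid

  sum-homo : ∀ N (f : Fin N → A.Carrier) → h (sumᴬ {N} f) B.≈ sumᴮ {N} (h ∘ f)
  sum-homo zero    f = 0#-homo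
  sum-homo (suc N) f = B.trans (+-homo (f fzero) (sumᴬ {N} (f ∘ fsuc)))
    (B.+-congˡ (sum-homo N (f ∘ fsuc)))

  ^-homo : ∀ a k → h (a ^ᴬ k) B.≈ h a ^ᴮ k
  ^-homo a zero    = 1#-homo
  ^-homo a (suc k) = B.trans (*-homo a (a ^ᴬ k)) (B.*-congˡ (^-homo a k))

  ⊛-homo : ∀ F G → (h ∘ (F SA.⊛ G)) SB.≋ (h ∘ F) SB.⊛ (h ∘ G)
  ⊛-homo F G n = B.trans
    (sum-homo (suc n) (λ k → F (toℕ k) A.* G (n ∸ toℕ k)))
    (sum-cong-≋ {suc n} λ k → *-homo (F (toℕ k)) (G (n ∸ toℕ k)))

  const-homo : ∀ a → (h ∘ SA.const a) SB.≋ SB.const (h a)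
  const-homo a zero    = B.refl
  const-homo a (suc n) = 0#-homo

  ^ˢ-homo : ∀ F k → (h ∘ (F SA.^ˢ k)) SB.≋ (h ∘ F) SB.^ˢ k
  ^ˢ-homo F zero    n = B.trans (const-homo A.1# n) (const1-cong n)
    where
    const1-cong : SB.const (h A.1#) SB.≋ SB.const B.1#
    const1-cong zero    = 1#-homo
    const1-cong (suc n) = B.refl
  ^ˢ-homo F (suc k) n = B.trans (⊛-homo F (F SA.^ˢ k) n)
    (SB.⊛-cong (SB.S.refl {h ∘ F}) (^ˢ-homo F k) n)

  ⊚-homo : ∀ P F → (h ∘ (P SA.⊚ F)) SB.≋ (h ∘ P) SB.⊚ (h ∘ F)
  ⊚-homo P F n = B.trans
    (sum-homo (suc n) (λ k → P (toℕ k) A.* (F SA.^ˢ toℕ k) n))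
    (sum-cong-≋ {suc n} λ k → B.trans (*-homo (P (toℕ k)) ((F SA.^ˢ toℕ k) n))
      (B.*-congˡ {h (P (toℕ k))} (^ˢ-homo F (toℕ k) n)))

  ⟨t⟩-homo : ∀ F a → (h ∘ (F SA.⟨ a t⟩)) SB.≋ (h ∘ F) SB.⟨ h a t⟩
  ⟨t⟩-homo F a n = B.trans (*-homo (F n) (a ^ᴬ n)) (B.*-congˡ (^-homo a n))

-- Factorials and the functional equation of the exponential.

nCk*[k!*[n∸k]!]≡n! : ∀ {n k} → k ≤ n → (n choose k) ℕ.* (k ! ℕ.* (n ∸ k) !) ≡ n !
nCk*[k!*[n∸k]!]≡n! {n} {k} k≤n = ≡.trans
  (≡.cong (ℕ._* (k ! ℕ.* (n ∸ k) !)) (nCk≡n!/k![n-k]! k≤n))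
  (m/n*n≡m {{ℕ._!*_!≢0 k (n ∸ k)}} (k![n∸k]!∣n! k≤n))

module Exponential {c ℓ} (R : CommutativeRing c ℓ)
  (1/_! : ℕ → CommutativeRing.Carrier R) where

  open CommutativeRing R hiding (rawRing)
  open SeriesProperties R
  open CompositionProperties R
  open RawSemiringDefinitions (RawRing.rawSemiring (CommutativeRing.rawRing R))
    using (_^_; _×_)
  open MonoidSum +-commutativeMonoid using (sum; sum-cong-≋)
  open SemiringSum semiring using (*-distribʳ-sum)
  open SemiringMult semiring using (×-assoc-*; ×1-homo-*; ×-congˡ; ×-congʳ)
  open CommutativeSemigroupProperties *-commutativeSemigroup
    using (interchange)
  open ≈-Reasoning setoid

  module _ (n!*1/n!≈1 : ∀ n → ((n !) × 1#) * (1/ n !) ≈ 1#) where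

    ×≈*1 : ∀ n a → n × a ≈ (n × 1#) * a
    ×≈*1 n a = sym (trans (×-assoc-* n 1# a) (×-congʳ n (*-identityˡ a)))

    nCk*1/n! : ∀ {n k} → k ≤ n → ((n choose k) × 1#) * (1/ n !) ≈ (1/ k !) * (1/ n ∸ k !)
    nCk*1/n! {n} {k} k≤n = begin
      b * (1/ n !)
        ≈⟨ *-identityʳ _ ⟨
      -- The inserted 1 is k! (n - k)! times its inverse. The two factorials combine with `b` to n!,
      -- which cancels `1/ n !` and leaves the desired inverses.
      b * (1/ n !) * 1#
        ≈⟨ *-congˡ (trans (interchange _ _ _ _) (trans (*-cong (n!*1/n!≈1 k) (n!*1/n!≈1 (n ∸ k))) (*-identityˡ 1#))) ⟨
      b * (1/ n !) * ((f * g) * ((1/ k !) * (1/ n ∸ k !)))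
        ≈⟨ *-assoc _ _ _ ⟨
      b * (1/ n !) * (f * g) * ((1/ k !) * (1/ n ∸ k !))
        ≈⟨ *-congʳ (trans (*-congʳ (*-comm _ _)) (trans (*-assoc _ _ _) (trans (*-comm _ _)
             (trans (*-congʳ bfg≈n!) (n!*1/n!≈1 n))))) ⟩
      1# * ((1/ k !) * (1/ n ∸ k !))
        ≈⟨ *-identityˡ _ ⟩
      (1/ k !) * (1/ n ∸ k !) ∎
      where
      b = (n choose k) × 1#
      f = (k !) × 1#
      g = ((n ∸ k) !) × 1#
      bfg≈n! : b * (f * g) ≈ (n !) × 1#
      bfg≈n! = begin
        b * (f * g)                              ≈⟨ *-congˡ (×1-homo-* (k !) ((n ∸ k) !)) ⟨
        b * ((k ! ℕ.* (n ∸ k) !) × 1#)           ≈⟨ ×1-homo-* (n choose k) (k ! ℕ.* (n ∸ k) !) ⟨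
        ((n choose k) ℕ.* (k ! ℕ.* (n ∸ k) !)) × 1#     ≈⟨ ×-congˡ (nCk*[k!*[n∸k]!]≡n! k≤n) ⟩
        (n !) × 1#                                 ∎

    private
      E : R⟦t⟧
      E n = 1/ n !

    -- The binomial theorem divided by n!, read coefficient by coefficient.
    exp-⟨t⟩-⊛ : ∀ a b → E ⟨ a t⟩ ⊛ E ⟨ b t⟩ ≋ E ⟨ a + b t⟩
    exp-⟨t⟩-⊛ a b n = sym (begin
      (1/ n !) * (a + b) ^ n
        ≈⟨ *-congˡ (theorem n a b) ⟩
      (1/ n !) * sum {suc n} (λ k → (n choose toℕ k) × (a ^ toℕ k * b ^ (n ∸ toℕ k)))
        ≈⟨ *-comm _ _ ⟩
      sum {suc n} (λ k → (n choose toℕ k) × (a ^ toℕ k * b ^ (n ∸ toℕ k))) * (1/ n !)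
        ≈⟨ *-distribʳ-sum {suc n} (1/ n !) (λ k → (n choose toℕ k) × (a ^ toℕ k * b ^ (n ∸ toℕ k))) ⟩
      sum {suc n} (λ k → (n choose toℕ k) × (a ^ toℕ k * b ^ (n ∸ toℕ k)) * (1/ n !))
        ≈⟨ sum-cong-≋ {suc n} (λ k → term (toℕ k) (Fin.toℕ≤pred[n] k)) ⟩
      sum {suc n} (λ k → (1/ toℕ k !) * a ^ toℕ k * ((1/ n ∸ toℕ k !) * b ^ (n ∸ toℕ k))) ∎)
      where
      open BinomialTheorem commutativeSemiring using (theorem)
      term : ∀ k → k ≤ n →
        (n choose k) × (a ^ k * b ^ (n ∸ k)) * (1/ n !) ≈ (1/ k !) * a ^ k * ((1/ n ∸ k !) * b ^ (n ∸ k))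
      term k k≤n = begin
        (n choose k) × (a ^ k * b ^ (n ∸ k)) * (1/ n !)          ≈⟨ *-congʳ (×≈*1 (n choose k) _) ⟩
        ((n choose k) × 1#) * (a ^ k * b ^ (n ∸ k)) * (1/ n !)   ≈⟨ *-assoc _ _ _ ⟩
        ((n choose k) × 1#) * (a ^ k * b ^ (n ∸ k) * (1/ n !))   ≈⟨ *-congˡ (*-comm _ _) ⟩
        ((n choose k) × 1#) * ((1/ n !) * (a ^ k * b ^ (n ∸ k))) ≈⟨ *-assoc _ _ _ ⟨
        ((n choose k) × 1#) * (1/ n !) * (a ^ k * b ^ (n ∸ k))   ≈⟨ *-congʳ (nCk*1/n! k≤n) ⟩
        (1/ k !) * (1/ n ∸ k !) * (a ^ k * b ^ (n ∸ k))   ≈⟨ interchange _ _ _ _ ⟩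
        (1/ k !) * a ^ k * ((1/ n ∸ k !) * b ^ (n ∸ k))   ∎

    -- With the scalars moved into the outer series, both factors are composites with `F`, so the
    -- functional equation in the plain variable t can be substituted into.
    exp-⊚-⊛ : ∀ F → F 0 ≈ 0# → ∀ a b → (E ⊚ (a · F)) ⊛ (E ⊚ (b · F)) ≋ E ⊚ ((a + b) · F)
    exp-⊚-⊛ F F₀≈0 a b n = begin
      ((E ⊚ (a · F)) ⊛ (E ⊚ (b · F))) n       ≈⟨ ⊛-cong (⊚-· a E F) (⊚-· b E F) n ⟩
      ((E ⟨ a t⟩ ⊚ F) ⊛ (E ⟨ b t⟩ ⊚ F)) n     ≈⟨ ⊛-⊚ F F₀≈0 (E ⟨ a t⟩) (E ⟨ b t⟩) n ⟨
      ((E ⟨ a t⟩ ⊛ E ⟨ b t⟩) ⊚ F) n           ≈⟨ ⊚-cong (exp-⟨t⟩-⊛ a b) (S.refl {F}) n ⟩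
      (E ⟨ a + b t⟩ ⊚ F) n                    ≈⟨ ⊚-· (a + b) E F n ⟨
      (E ⊚ ((a + b) · F)) n                   ∎

-- Polynomials, their evaluations and their fractions.

-- Each law of the ring of fractions, for a/b, c/d and e/f, after
-- cross-multiplication.
module FractionIdentities {c ℓ} (R : CommutativeRing c ℓ) where

  open CommutativeRing R
  open SemiringSolver commutativeSemiring
  open ≈-Reasoning setoid

  -- Chaining two cross-multiplied equations leaves the middle denominator `d` as a common factor.
  -- It is cancelled afterwards with `Nonzeroₚ-cancelʳ`, so transitivity is where the absence of
  -- zero divisors enters.
  trans-id : ∀ a b c d e f → a * d ≈ c * b → c * f ≈ e * d → (a * f) * d ≈ (e * b) * d
  trans-id a b c d e f ad≈cb cf≈ed = begin
    (a * f) * d   ≈⟨ solve 3 (λ a f d → (a :* f) :* d := (a :* d) :* f) refl a f d ⟩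
    (a * d) * f   ≈⟨ *-congʳ ad≈cb ⟩
    (c * b) * f   ≈⟨ solve 3 (λ c b f → (c :* b) :* f := (c :* f) :* b) refl c b f ⟩
    (c * f) * b   ≈⟨ *-congʳ cf≈ed ⟩
    (e * d) * b   ≈⟨ solve 3 (λ e d b → (e :* d) :* b := (e :* b) :* d) refl e d b ⟩
    (e * b) * d   ∎

  +-cong-id : ∀ a b a′ b′ c d c′ d′ → a * b′ ≈ a′ * b → c * d′ ≈ c′ * d →
    (a * d + c * b) * (b′ * d′) ≈ (a′ * d′ + c′ * b′) * (b * d)
  +-cong-id a b a′ b′ c d c′ d′ p q = begin
    (a * d + c * b) * (b′ * d′)
      ≈⟨ solve 6 (λ a b b′ c d d′ → (a :* d :+ c :* b) :* (b′ :* d′) :=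
           (a :* b′) :* (d :* d′) :+ (c :* d′) :* (b :* b′)) refl a b b′ c d d′ ⟩
    (a * b′) * (d * d′) + (c * d′) * (b * b′)
      ≈⟨ +-cong (*-congʳ p) (*-congʳ q) ⟩
    (a′ * b) * (d * d′) + (c′ * d) * (b * b′)
      ≈⟨ solve 6 (λ a′ b b′ c′ d d′ → (a′ :* b) :* (d :* d′) :+ (c′ :* d) :* (b :* b′) :=
           (a′ :* d′ :+ c′ :* b′) :* (b :* d)) refl a′ b b′ c′ d d′ ⟩
    (a′ * d′ + c′ * b′) * (b * d) ∎

  *-cong-id : ∀ a b a′ b′ c d c′ d′ → a * b′ ≈ a′ * b → c * d′ ≈ c′ * d →
    (a * c) * (b′ * d′) ≈ (a′ * c′) * (b * d)
  *-cong-id a b a′ b′ c d c′ d′ p q = begin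
    (a * c) * (b′ * d′)     ≈⟨ solve 4 (λ a c b′ d′ → (a :* c) :* (b′ :* d′) := (a :* b′) :* (c :* d′)) refl a c b′ d′ ⟩
    (a * b′) * (c * d′)     ≈⟨ *-cong p q ⟩
    (a′ * b) * (c′ * d)     ≈⟨ solve 4 (λ a′ b c′ d → (a′ :* b) :* (c′ :* d) := (a′ :* c′) :* (b :* d)) refl a′ b c′ d ⟩
    (a′ * c′) * (b * d)     ∎

  -‿cong-id : ∀ a b a′ b′ → a * b′ ≈ a′ * b → - a * b′ ≈ - a′ * b
  -‿cong-id a b a′ b′ p = begin
    - a * b′      ≈⟨ RingProperties.-‿distribˡ-* ring a b′ ⟨
    - (a * b′)    ≈⟨ -‿cong p ⟩
    - (a′ * b)    ≈⟨ RingProperties.-‿distribˡ-* ring a′ b ⟩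
    - a′ * b      ∎

  +-assoc-id : ∀ a b c d e f →
    ((a * d + c * b) * f + e * (b * d)) * (b * (d * f)) ≈
    (a * (d * f) + (c * f + e * d) * b) * ((b * d) * f)
  +-assoc-id = solve 6 (λ a b c d e f →
    ((a :* d :+ c :* b) :* f :+ e :* (b :* d)) :* (b :* (d :* f)) :=
    (a :* (d :* f) :+ (c :* f :+ e :* d) :* b) :* ((b :* d) :* f)) refl

  +-comm-id : ∀ a b c d → (a * d + c * b) * (d * b) ≈ (c * b + a * d) * (b * d)
  +-comm-id = solve 4 (λ a b c d →
    (a :* d :+ c :* b) :* (d :* b) := (c :* b :+ a :* d) :* (b :* d)) refl

  +-identityˡ-id : ∀ a b → (0# * b + a * 1#) * b ≈ a * (1# * b)
  +-identityˡ-id = solve 2 (λ a b → (con 0 :* b :+ a :* con 1) :* b := a :* (con 1 :* b))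
    refl

  -‿inverseˡ-id : ∀ a b → (- a * b + a * b) * 1# ≈ 0# * (b * b)
  -‿inverseˡ-id a b = begin
    (- a * b + a * b) * 1#  ≈⟨ *-identityʳ _ ⟩
    - a * b + a * b         ≈⟨ distribʳ b (- a) a ⟨
    (- a + a) * b           ≈⟨ *-congʳ (-‿inverseˡ a) ⟩
    0# * b                  ≈⟨ zeroˡ b ⟩
    0#                      ≈⟨ zeroˡ (b * b) ⟨
    0# * (b * b)            ∎

  *-assoc-id : ∀ a b c d e f → ((a * c) * e) * (b * (d * f)) ≈ (a * (c * e)) * ((b * d) * f)
  *-assoc-id = solve 6 (λ a b c d e f →
    ((a :* c) :* e) :* (b :* (d :* f)) := (a :* (c :* e)) :* ((b :* d) :* f)) refl

  *-comm-id : ∀ a b c d → (a * c) * (d * b) ≈ (c * a) * (b * d)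
  *-comm-id = solve 4 (λ a b c d → (a :* c) :* (d :* b) := (c :* a) :* (b :* d)) refl

  *-identityˡ-id : ∀ a b → (1# * a) * b ≈ a * (1# * b)
  *-identityˡ-id = solve 2 (λ a b → (con 1 :* a) :* b := a :* (con 1 :* b)) refl

  distribˡ-id : ∀ a b c d e f →
    (a * (c * f + e * d)) * ((b * d) * (b * f)) ≈
    ((a * c) * (b * f) + (a * e) * (b * d)) * (b * (d * f))
  distribˡ-id = solve 6 (λ a b c d e f →
    (a :* (c :* f :+ e :* d)) :* ((b :* d) :* (b :* f)) :=
    ((a :* c) :* (b :* f) :+ (a :* e) :* (b :* d)) :* (b :* (d :* f))) refl

  ι-+-id : ∀ a c → (a + c) * (1# * 1#) ≈ (a * 1# + c * 1#) * 1#
  ι-+-id = solve 2 (λ a c → (a :+ c) :* (con 1 :* con 1) := (a :* con 1 :+ c :* con 1) :* con 1) refl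

  ι-*-id : ∀ a c → (a * c) * (1# * 1#) ≈ (a * c) * 1#
  ι-*-id = solve 2 (λ a c → (a :* c) :* (con 1 :* con 1) := (a :* c) :* con 1) refl

  inverseʳ-id : ∀ a → (a * 1#) * 1# ≈ 1# * (1# * a)
  inverseʳ-id = solve 1 (λ a → (a :* con 1) :* con 1 := con 1 :* (con 1 :* a)) refl

  cancel-id : ∀ a b q → a * q ≈ b * q → (a - b) * q ≈ 0#
  cancel-id a b q p = begin
    (a - b) * q         ≈⟨ distribʳ q a (- b) ⟩
    a * q + - b * q     ≈⟨ +-cong p (sym (RingProperties.-‿distribˡ-* ring b q)) ⟩
    b * q + - (b * q)   ≈⟨ -‿inverseʳ _ ⟩
    0#                  ∎

module Polynomials {c ℓ₁ ℓ₂} (K : HeytingField c ℓ₁ ℓ₂) (char0 : CharacteristicZero K) where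

  open Sheffer K char0

  private
    module K = HeytingField K
    module R = CommutativeRing (commutativeRing K)
    module SR = SeriesProperties (commutativeRing K)

  open CommutativeRing (commutativeRing K)
    using ( refl; sym; trans; setoid; +-cong; +-congˡ; +-congʳ; *-congˡ; *-congʳ
          ; +-assoc; +-identityˡ; +-identityʳ; *-assoc; *-comm; *-identityʳ
          ; zeroˡ; zeroʳ; distribˡ; distribʳ )
  open RingProperties R.ring using (-0#≈0#; -‿distribʳ-*; -‿+-comm)
  open CommutativeSemigroupProperties R.+-commutativeSemigroup using (interchange)
  open HeytingProperties K.heytingCommutativeRing using (#-congʳ)

  coeff-+ : ∀ p q n → coeff (p +ₚ q) n ≈ coeff p n + coeff q n
  coeff-+ []      q       n       = sym (+-identityˡ _)
  coeff-+ (a ∷ p) []      n       = sym (+-identityʳ _)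
  coeff-+ (a ∷ p) (b ∷ q) zero    = refl
  coeff-+ (a ∷ p) (b ∷ q) (suc n) = coeff-+ p q n

  coeff-map-* : ∀ a q n → coeff (map (a *_) q) n ≈ a * coeff q n
  coeff-map-* a []      n       = sym (zeroʳ a)
  coeff-map-* a (b ∷ q) zero    = refl
  coeff-map-* a (b ∷ q) (suc n) = coeff-map-* a q n

  coeff-neg : ∀ p n → coeff (map -_ p) n ≈ - coeff p n
  coeff-neg []      n       = sym -0#≈0#
  coeff-neg (a ∷ p) zero    = refl
  coeff-neg (a ∷ p) (suc n) = coeff-neg p n

  coeff-C : ∀ a n → coeff (C a) n ≈ SR.const a n
  coeff-C a zero    = refl
  coeff-C a (suc n) = refl

  coeff-* : ∀ p q → coeff (p *ₚ q) SR.≋ coeff p SR.⊛ coeff q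
  coeff-* []      q n       = sym (SR.0-⊛ (coeff q) n)
  coeff-* (a ∷ p) q zero    = trans (coeff-+ (map (a *_) q) (0# ∷ (p *ₚ q)) 0)
    (+-cong (coeff-map-* a q 0) refl)
  coeff-* (a ∷ p) q (suc n) = trans (coeff-+ (map (a *_) q) (0# ∷ (p *ₚ q)) (suc n))
    (+-cong (coeff-map-* a q (suc n)) (coeff-* p q n))

  -- Injectivity is the identity function, as polynomials are compared by coefficients. The ring
  -- laws of `K[x]` are therefore inherited from the series ring rather than proved on lists.
  coeff-isRingMonomorphism :
    IsRingMonomorphism polyRing (CommutativeRing.rawRing SR.seriesRing) coeff
  coeff-isRingMonomorphism = record
    { isRingHomomorphism = record
      { isSemiringHomomorphism = record
        { isNearSemiringHomomorphism = record
          { +-isMonoidHomomorphism = record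
            { isMagmaHomomorphism = record
              { isRelHomomorphism = record { cong = λ p≈q → p≈q }
              ; homo = coeff-+
              }
            ; ε-homo = λ n → sym (SR.const0≈0 n)
            }
          ; *-homo = coeff-*
          }
        ; 1#-homo = coeff-C 1#
        }
      ; -‿homo = coeff-neg
      }
    ; injective = λ p≈q → p≈q
    }

  polynomialRing : CommutativeRing c ℓ₁
  polynomialRing = record
    { Carrier = K[x]
    ; _≈_     = P._≈_
    ; _+_     = _+ₚ_
    ; _*_     = _*ₚ_
    ; -_      = map -_
    ; 0#      = []
    ; 1#      = 1# ∷ []
    ; isCommutativeRing =
        RingMonomorphism.isCommutativeRing coeff-isRingMonomorphism SR.⊛-isCommutativeRing
    }

  C-isRingHomomorphism : IsRingHomomorphism R.rawRing polyRing C
  C-isRingHomomorphism = record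
    { isSemiringHomomorphism = record
      { isNearSemiringHomomorphism = record
        { +-isMonoidHomomorphism = record
          { isMagmaHomomorphism = record
            { isRelHomomorphism = record { cong = λ { a≈b zero → a≈b ; a≈b (suc n) → refl } }
            ; homo = λ { a b zero → refl ; a b (suc n) → refl }
            }
          ; ε-homo = λ { zero → refl ; (suc n) → refl }
          }
        ; *-homo = λ { a b zero → sym (+-identityʳ _) ; a b (suc n) → refl }
        }
      ; 1#-homo = λ n → refl
      }
    ; -‿homo = λ a n → refl
    }

  eval : Carrier → K[x] → Carrier
  eval a []      = 0#
  eval a (b ∷ p) = b + a * eval a p

  module _ (a : Carrier) where

    open ≈-Reasoning setoid

    -- Equal polynomials may be lists of different lengths; this disposes of the surplus tail in
    -- `eval-cong`.
    eval-≈0 : ∀ p → (∀ n → coeff p n ≈ 0#) → eval a p ≈ 0#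
    eval-≈0 []      p≈0 = refl
    eval-≈0 (b ∷ p) p≈0 = trans
      (+-cong (p≈0 0) (trans (*-congˡ (eval-≈0 p (p≈0 ∘ suc))) (zeroʳ a)))
      (+-identityˡ _)

    eval-cong : ∀ p q → p P.≈ q → eval a p ≈ eval a q
    eval-cong []      q       p≈q = sym (eval-≈0 q (λ n → sym (p≈q n)))
    eval-cong (b ∷ p) []      p≈q = eval-≈0 (b ∷ p) p≈q
    eval-cong (b ∷ p) (d ∷ q) p≈q = +-cong (p≈q 0) (*-congˡ (eval-cong p q (p≈q ∘ suc)))

    eval-+ : ∀ p q → eval a (p +ₚ q) ≈ eval a p + eval a q
    eval-+ []      q       = sym (+-identityˡ _)
    eval-+ (b ∷ p) []      = sym (+-identityʳ _)
    eval-+ (b ∷ p) (d ∷ q) = begin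
      b + d + a * eval a (p +ₚ q)               ≈⟨ +-congˡ (*-congˡ (eval-+ p q)) ⟩
      b + d + a * (eval a p + eval a q)         ≈⟨ +-congˡ (distribˡ _ _ _) ⟩
      b + d + (a * eval a p + a * eval a q)     ≈⟨ interchange _ _ _ _ ⟩
      b + a * eval a p + (d + a * eval a q)     ∎

    eval-map-* : ∀ b q → eval a (map (b *_) q) ≈ b * eval a q
    eval-map-* b []      = sym (zeroʳ b)
    eval-map-* b (d ∷ q) = begin
      b * d + a * eval a (map (b *_) q)   ≈⟨ +-congˡ (*-congˡ (eval-map-* b q)) ⟩
      b * d + a * (b * eval a q)          ≈⟨ +-congˡ (trans (sym (*-assoc _ _ _)) (trans (*-congʳ (*-comm _ _)) (*-assoc _ _ _))) ⟩
      b * d + b * (a * eval a q)          ≈⟨ distribˡ _ _ _ ⟨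
      b * (d + a * eval a q)              ∎

    eval-* : ∀ p q → eval a (p *ₚ q) ≈ eval a p * eval a q
    eval-* []      q = sym (zeroˡ _)
    eval-* (b ∷ p) q = begin
      eval a (map (b *_) q +ₚ (0# ∷ (p *ₚ q)))
        ≈⟨ eval-+ (map (b *_) q) (0# ∷ (p *ₚ q)) ⟩
      eval a (map (b *_) q) + (0# + a * eval a (p *ₚ q))
        ≈⟨ +-cong (eval-map-* b q) (trans (+-identityˡ _) (*-congˡ (eval-* p q))) ⟩
      b * eval a q + a * (eval a p * eval a q)
        ≈⟨ +-congˡ (*-assoc _ _ _) ⟨
      b * eval a q + a * eval a p * eval a q
        ≈⟨ distribʳ _ _ _ ⟨
      (b + a * eval a p) * eval a q ∎

    eval-neg : ∀ p → eval a (map -_ p) ≈ - eval a p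
    eval-neg []      = sym -0#≈0#
    eval-neg (b ∷ p) = begin
      - b + a * eval a (map -_ p)   ≈⟨ +-congˡ (*-congˡ (eval-neg p)) ⟩
      - b + a * - eval a p          ≈⟨ +-congˡ (-‿distribʳ-* _ _) ⟨
      - b + - (a * eval a p)        ≈⟨ -‿+-comm _ _ ⟩
      - (b + a * eval a p)          ∎

    eval-C : ∀ b → eval a (C b) ≈ b
    eval-C b = trans (+-congˡ (zeroʳ a)) (+-identityʳ b)

    eval-x : eval a x ≈ a
    eval-x = trans (+-identityˡ _) (trans (*-congˡ (eval-C 1#)) (*-identityʳ a))

    eval-isRingHomomorphism : IsRingHomomorphism polyRing R.rawRing (eval a)
    eval-isRingHomomorphism = record
      { isSemiringHomomorphism = record
        { isNearSemiringHomomorphism = record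
          { +-isMonoidHomomorphism = record
            { isMagmaHomomorphism = record
              { isRelHomomorphism = record { cong = λ {p} {q} → eval-cong p q }
              ; homo = eval-+
              }
            ; ε-homo = refl
            }
          ; *-homo = eval-*
          }
        ; 1#-homo = eval-C 1#
        }
      ; -‿homo = eval-neg
      }

  private
    module PR = CommutativeRing polynomialRing
    module FI = FractionIdentities polynomialRing

  -- If some coefficient of p - q were apart from 0, then by `Nonzeroₚ-*` so would be some
  -- coefficient of (p - q) r, which is zero. Tightness of the apartness turns this refutation into
  -- equality.
  Nonzeroₚ-cancelʳ : ∀ p q r → Nonzeroₚ r → p *ₚ r P.≈ q *ₚ r → p P.≈ q
  Nonzeroₚ-cancelʳ p q r r≢0 pr≈qr n = begin
    coeff p n                                 ≈⟨ +-identityʳ _ ⟨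
    coeff p n + 0#                            ≈⟨ +-congˡ (R.-‿inverseˡ (coeff q n)) ⟨
    coeff p n + (- coeff q n + coeff q n)     ≈⟨ +-assoc _ _ _ ⟨
    coeff p n + - coeff q n + coeff q n       ≈⟨ +-congʳ p-q≈0 ⟩
    0# + coeff q n                            ≈⟨ +-identityˡ _ ⟩
    coeff q n                                 ∎
    where
    open ≈-Reasoning setoid
    p-q≈0ₙ : coeff (p -ₚ q) n ≈ 0#
    p-q≈0ₙ = proj₁ (K.tight _ _) λ d#0 → nonzero⇒⊥ (Nonzeroₚ-* (p -ₚ q) r (n , d#0) r≢0)
      where
      nonzero⇒⊥ : Nonzeroₚ ((p -ₚ q) *ₚ r) → _
      nonzero⇒⊥ (k , e#0) = K.#-irrefl refl (#-congʳ (FI.cancel-id p q r pr≈qr k) e#0)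
    p-q≈0 : coeff p n + - coeff q n ≈ 0#
    p-q≈0 = trans (sym (trans (coeff-+ p (map -_ q) n) (+-congˡ (coeff-neg q n)))) p-q≈0ₙ

  open K⟨x⟩ using (num; den; den≢0)

  rational-isCommutativeRing : IsCommutativeRing
    (RawRing._≈_ ratRing) (RawRing._+_ ratRing) (RawRing._*_ ratRing)
    (RawRing.-_ ratRing) (RawRing.0# ratRing) (RawRing.1# ratRing)
  rational-isCommutativeRing = record
    { isRing = record
      { +-isAbelianGroup = record
        { isGroup = record
          { isMonoid = record
            { isSemigroup = record
              { isMagma = record
                { isEquivalence = record
                  { refl  = λ {r} → PR.refl {num r *ₚ den r}
                  ; sym   = λ {r} {s} p → PR.sym {num r *ₚ den s} {num s *ₚ den r} p
                  ; trans = λ {r} {s} {t} → transᵣ r s t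
                  }
                ; ∙-cong = λ {r} {r′} {s} {s′} → +-congᵣ r r′ s s′
                }
              ; assoc = +-assocᵣ
              }
            ; identity = +-idˡ , λ r → transᵣ (r +ᵣ 0ᵣ) (0ᵣ +ᵣ r) r (+-commᵣ r 0ᵣ) (+-idˡ r)
            }
          ; inverse = invˡ , invʳ
          ; ⁻¹-cong = λ {r} {s} → FI.-‿cong-id (num r) (den r) (num s) (den s)
          }
        ; comm = +-commᵣ
        }
      ; *-cong     = λ {r} {r′} {s} {s′} → *-congᵣ r r′ s s′
      ; *-assoc    = *-assocᵣ
      ; *-identity = *-idˡ , *-idʳ
      ; distrib    = distˡ , distʳ
      }
    ; *-comm = *-commᵣ
    }
    where
    open RawRing ratRing using () renaming (_≈_ to _≈ᵣ_; _+_ to _+ᵣ_; _*_ to _*ᵣ_; -_ to -ᵣ_; 0# to 0ᵣ; 1# to 1ᵣ)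
    transᵣ : ∀ r s t → r ≈ᵣ s → s ≈ᵣ t → r ≈ᵣ t
    transᵣ r s t p q =
      Nonzeroₚ-cancelʳ (num r *ₚ den t) (num t *ₚ den r) (den s) (den≢0 s)
        (FI.trans-id (num r) (den r) (num s) (den s) (num t) (den t) p q)
    +-congᵣ : ∀ r r′ s s′ → r ≈ᵣ r′ → s ≈ᵣ s′ → r +ᵣ s ≈ᵣ r′ +ᵣ s′
    +-congᵣ r r′ s s′ =
      FI.+-cong-id (num r) (den r) (num r′) (den r′) (num s) (den s) (num s′) (den s′)
    *-congᵣ : ∀ r r′ s s′ → r ≈ᵣ r′ → s ≈ᵣ s′ → r *ᵣ s ≈ᵣ r′ *ᵣ s′
    *-congᵣ r r′ s s′ =
      FI.*-cong-id (num r) (den r) (num r′) (den r′) (num s) (den s) (num s′) (den s′)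
    *-assocᵣ : ∀ r s t → (r *ᵣ s) *ᵣ t ≈ᵣ r *ᵣ (s *ᵣ t)
    *-assocᵣ r s t = FI.*-assoc-id (num r) (den r) (num s) (den s) (num t) (den t)
    +-assocᵣ : ∀ r s t → (r +ᵣ s) +ᵣ t ≈ᵣ r +ᵣ (s +ᵣ t)
    +-assocᵣ r s t = FI.+-assoc-id (num r) (den r) (num s) (den s) (num t) (den t)
    +-commᵣ : ∀ r s → r +ᵣ s ≈ᵣ s +ᵣ r
    +-commᵣ r s = FI.+-comm-id (num r) (den r) (num s) (den s)
    *-commᵣ : ∀ r s → r *ᵣ s ≈ᵣ s *ᵣ r
    *-commᵣ r s = FI.*-comm-id (num r) (den r) (num s) (den s)
    +-idˡ : ∀ r → 0ᵣ +ᵣ r ≈ᵣ r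
    +-idˡ r = FI.+-identityˡ-id (num r) (den r)
    invˡ : ∀ r → (-ᵣ r) +ᵣ r ≈ᵣ 0ᵣ
    invˡ r = FI.-‿inverseˡ-id (num r) (den r)
    invʳ : ∀ r → r +ᵣ (-ᵣ r) ≈ᵣ 0ᵣ
    invʳ r = transᵣ (r +ᵣ (-ᵣ r)) ((-ᵣ r) +ᵣ r) 0ᵣ (+-commᵣ r (-ᵣ r)) (invˡ r)
    *-idˡ : ∀ r → 1ᵣ *ᵣ r ≈ᵣ r
    *-idˡ r = FI.*-identityˡ-id (num r) (den r)
    *-idʳ : ∀ r → r *ᵣ 1ᵣ ≈ᵣ r
    *-idʳ r = transᵣ (r *ᵣ 1ᵣ) (1ᵣ *ᵣ r) r (*-commᵣ r 1ᵣ) (*-idˡ r)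
    distˡ : ∀ r s t → r *ᵣ (s +ᵣ t) ≈ᵣ (r *ᵣ s) +ᵣ (r *ᵣ t)
    distˡ r s t = FI.distribˡ-id (num r) (den r) (num s) (den s) (num t) (den t)
    distʳ : ∀ r s t → (s +ᵣ t) *ᵣ r ≈ᵣ (s *ᵣ r) +ᵣ (t *ᵣ r)
    distʳ r s t = transᵣ ((s +ᵣ t) *ᵣ r) (r *ᵣ (s +ᵣ t)) ((s *ᵣ r) +ᵣ (t *ᵣ r))
      (*-commᵣ (s +ᵣ t) r)
      (transᵣ (r *ᵣ (s +ᵣ t)) ((r *ᵣ s) +ᵣ (r *ᵣ t)) ((s *ᵣ r) +ᵣ (t *ᵣ r)) (distˡ r s t)
        (+-congᵣ (r *ᵣ s) (s *ᵣ r) (r *ᵣ t) (t *ᵣ r) (*-commᵣ r s) (*-commᵣ r t)))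

  rationalRing : CommutativeRing _ ℓ₁
  rationalRing = record { isCommutativeRing = rational-isCommutativeRing }

  ι-isRingHomomorphism : IsRingHomomorphism polyRing ratRing ι
  ι-isRingHomomorphism = record
    { isSemiringHomomorphism = record
      { isNearSemiringHomomorphism = record
        { +-isMonoidHomomorphism = record
          { isMagmaHomomorphism = record
            { isRelHomomorphism = record { cong = λ {p} {q} p≈q →
                PR.*-cong {p} {q} {1# ∷ []} {1# ∷ []} p≈q (λ _ → refl) }
            ; homo = FI.ι-+-id
            }
          ; ε-homo = λ _ → refl
          }
        ; *-homo = FI.ι-*-id
        }
      ; 1#-homo = λ _ → refl
      }
    ; -‿homo = λ p _ → refl
    }

  ι-inverseʳ : ∀ p (p≢0 : Nonzeroₚ p) →
    RawRing._≈_ ratRing (RawRing._*_ ratRing (ι p) (inverseᵣ (ι p) p≢0)) (RawRing.1# ratRing)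
  ι-inverseʳ p p≢0 = FI.inverseʳ-id p

-- Binomial coefficients and their generating functions.

-- k! times n choose k is the falling factorial of n with k factors, and this is its recursion. For
-- k ≤ n both sides become (n + 1)! after multiplication by (n - k)!; for k > n both vanish.
[n+1]*[k!*nCk]≡[k+1]!*[n+1]C[k+1] : ∀ n k → suc n ℕ.* (k ! ℕ.* (n choose k)) ≡ (suc k) ! ℕ.* (suc n choose suc k)
[n+1]*[k!*nCk]≡[k+1]!*[n+1]C[k+1] n k with k ℕ.≤? n
... | yes k≤n = ℕ.*-cancelʳ-≡ _ _ ((n ∸ k) !) {{ℕ._!≢0 (n ∸ k)}} (begin
  suc n ℕ.* (k ! ℕ.* (n choose k)) ℕ.* (n ∸ k) !       ≡⟨ ℕ.*-assoc (suc n) (k ! ℕ.* (n choose k)) ((n ∸ k) !) ⟩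
  suc n ℕ.* (k ! ℕ.* (n choose k) ℕ.* (n ∸ k) !)       ≡⟨ ≡.cong (λ z → suc n ℕ.* (z ℕ.* (n ∸ k) !)) (ℕ.*-comm (k !) _) ⟩
  suc n ℕ.* ((n choose k) ℕ.* k ! ℕ.* (n ∸ k) !)       ≡⟨ ≡.cong (suc n ℕ.*_) (ℕ.*-assoc (n choose k) _ _) ⟩
  suc n ℕ.* ((n choose k) ℕ.* (k ! ℕ.* (n ∸ k) !))     ≡⟨ ≡.cong (suc n ℕ.*_) (nCk*[k!*[n∸k]!]≡n! k≤n) ⟩
  (suc n) !                                       ≡⟨ nCk*[k!*[n∸k]!]≡n! (s≤s k≤n) ⟨
  (suc n choose suc k) ℕ.* ((suc k) ! ℕ.* (n ∸ k) !)   ≡⟨ ℕ.*-assoc (suc n choose suc k) _ _ ⟨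
  (suc n choose suc k) ℕ.* (suc k) ! ℕ.* (n ∸ k) !     ≡⟨ ≡.cong (ℕ._* (n ∸ k) !) (ℕ.*-comm (suc n choose suc k) _) ⟩
  (suc k) ! ℕ.* (suc n choose suc k) ℕ.* (n ∸ k) !     ∎)
  where open ≡-Reasoning
... | no k≰n = begin
  suc n ℕ.* (k ! ℕ.* (n choose k))      ≡⟨ ≡.cong (λ z → suc n ℕ.* (k ! ℕ.* z)) (k>n⇒nCk≡0 (ℕ.≰⇒> k≰n)) ⟩
  suc n ℕ.* (k ! ℕ.* 0)            ≡⟨ ≡.cong (suc n ℕ.*_) (ℕ.*-zeroʳ (k !)) ⟩
  suc n ℕ.* 0                      ≡⟨ ℕ.*-zeroʳ (suc n) ⟩
  0                                ≡⟨ ℕ.*-zeroʳ ((suc k) !) ⟨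
  (suc k) ! ℕ.* 0                  ≡⟨ ≡.cong ((suc k) ! ℕ.*_) (k>n⇒nCk≡0 (s≤s (ℕ.≰⇒> k≰n))) ⟨
  (suc k) ! ℕ.* (suc n choose suc k)    ∎
  where open ≡-Reasoning

module BinomialSeries {c ℓ} (R : CommutativeRing c ℓ) where

  open CommutativeRing R hiding (rawRing)
  open SeriesProperties R
  open CompositionProperties R
  open RawSemiringDefinitions (RawRing.rawSemiring (CommutativeRing.rawRing R))
    using (_×_; product)
  open MonoidSum *-commutativeMonoid using () renaming (sum-cong-≋ to product-cong)
  open SemiringMult semiring using (×1-homo-*; ×-congˡ; ×-homo-+; ×-homo-1)
  open RingProperties ring using (-0#≈0#; -‿+-comm)
  open CommutativeSemigroupProperties +-commutativeSemigroup
    using (interchange)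
  open ≈-Reasoning setoid

  [a+b]-[a+d]≈b-d : ∀ a b d → (a + b) - (a + d) ≈ b - d
  [a+b]-[a+d]≈b-d a b d = begin
    (a + b) - (a + d)         ≈⟨ +-congˡ (-‿+-comm a d) ⟨
    (a + b) + (- a + - d)     ≈⟨ interchange _ _ _ _ ⟩
    (a - a) + (b - d)         ≈⟨ +-congʳ (-‿inverseʳ a) ⟩
    0# + (b - d)              ≈⟨ +-identityˡ _ ⟩
    b - d                     ∎

  [a+b]-b≈a : ∀ a b → (a + b) - b ≈ a
  [a+b]-b≈a a b = trans (+-assoc _ _ _) (trans (+-congˡ (-‿inverseʳ b)) (+-identityʳ a))

  -- The factor at i = 0 is N + 1, and the remaining factors (N + 1) - (i + 1) form the falling
  -- factorial of N. At N = 0 the first factor kills the product, in agreement with 0 choose n + 1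
  -- being 0.
  fallingFactorial : ∀ N n →
    product {n} (λ i → (N × 1#) - (toℕ i × 1#)) ≈ (n ! ℕ.* (N choose n)) × 1#
  fallingFactorial N       zero    = sym (×-homo-1 1#)
  fallingFactorial zero    (suc n) = begin
    (0# - 0#) * product {n} (λ i → 0# - (suc (toℕ i) × 1#))
      ≈⟨ *-congʳ (-‿inverseʳ 0#) ⟩
    0# * product {n} (λ i → 0# - (suc (toℕ i) × 1#))
      ≈⟨ zeroˡ _ ⟩
    0#
      ≈⟨ ×-congˡ {1#} (≡.sym (ℕ.*-zeroʳ ((suc n) !))) ⟩
    ((suc n) ! ℕ.* 0) × 1# ∎
  fallingFactorial (suc N) (suc n) = begin
    ((suc N × 1#) - 0#) * product {n} (λ i → (suc N × 1#) - (suc (toℕ i) × 1#))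
      ≈⟨ *-cong (trans (+-congˡ -0#≈0#) (+-identityʳ _))
           (product-cong {n} λ i → [a+b]-[a+d]≈b-d 1# (N × 1#) (toℕ i × 1#)) ⟩
    (suc N × 1#) * product {n} (λ i → (N × 1#) - (toℕ i × 1#))
      ≈⟨ *-congˡ (fallingFactorial N n) ⟩
    (suc N × 1#) * ((n ! ℕ.* (N choose n)) × 1#)
      ≈⟨ ×1-homo-* (suc N) (n ! ℕ.* (N choose n)) ⟨
    (suc N ℕ.* (n ! ℕ.* (N choose n))) × 1#
      ≈⟨ ×-congˡ {1#} ([n+1]*[k!*nCk]≡[k+1]!*[n+1]C[k+1] N n) ⟩
    ((suc n) ! ℕ.* (suc N choose suc n)) × 1# ∎

  -- The successor in `suc m` pays for the final - 1, and `k ≤ n` pays for - k, so no negative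
  -- argument arises.
  shifted-argument : ∀ m {n k} → k ≤ n →
    (suc m × 1#) + (n × 1#) - (k × 1#) - (1 × 1#) ≈ (m ℕ.+ (n ∸ k)) × 1#
  shifted-argument m {n} {k} k≤n = begin
    (1# + M) + (n × 1#) - (k × 1#) - (1 × 1#)
      ≈⟨ +-cong (+-congʳ (+-congˡ (trans (×-congˡ {1#} (≡.sym (ℕ.m∸n+n≡m k≤n))) (×-homo-+ 1# (n ∸ k) k)))) (-‿cong (+-identityʳ 1#)) ⟩
    (1# + M) + (J + k × 1#) - (k × 1#) - 1#
      ≈⟨ +-congʳ (trans (+-assoc _ _ _) (+-congˡ ([a+b]-b≈a J (k × 1#)))) ⟩
    (1# + M) + J - 1#
      ≈⟨ +-congʳ (trans (+-assoc _ _ _) (+-comm _ _)) ⟩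
    (M + J) + 1# - 1#
      ≈⟨ [a+b]-b≈a (M + J) 1# ⟩
    M + J
      ≈⟨ ×-homo-+ 1# m (n ∸ k) ⟨
    (m ℕ.+ (n ∸ k)) × 1# ∎
    where
    M = m × 1#
    J = (n ∸ k) × 1#

  t⊛-zero : ∀ F → (t ⊛ F) 0 ≈ 0#
  t⊛-zero F = ⊛-zero-0 t refl F

  t⊛-suc : ∀ F n → (t ⊛ F) (suc n) ≈ F n
  t⊛-suc F n = trans (⊛-suc-0 t refl F n) (trans (⊛-cong t∘suc (S.refl {F}) n) (⊛-identityˡ F n))
    where
    t∘suc : t ∘ suc ≋ const 1#
    t∘suc zero    = refl
    t∘suc (suc _) = refl

  -- In the application the variable of these series is x, and this is the image of the polynomial 1
  -- - x.
  1-t : R⟦t⟧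
  1-t = const 1# ⊖ t

  1-t⊛ : ∀ F → 1-t ⊛ F ≋ F ⊖ t ⊛ F
  1-t⊛ F n = begin
    (1-t ⊛ F) n                                 ≈⟨ ⊛-distribʳ F (const 1#) (λ k → - t k) n ⟩
    (const 1# ⊛ F) n + ((λ k → - t k) ⊛ F) n    ≈⟨ +-cong (⊛-identityˡ F n)
                                                    (sym (RingProperties.-‿distribˡ-* S.ring t F n)) ⟩
    F n - (t ⊛ F) n                             ∎

  1-t⊛-zero : ∀ F → (1-t ⊛ F) 0 ≈ F 0
  1-t⊛-zero F = trans (1-t⊛ F 0) (trans (+-congˡ (trans (-‿cong (t⊛-zero F)) -0#≈0#)) (+-identityʳ _))

  1-t⊛-suc : ∀ F n → (1-t ⊛ F) (suc n) ≈ F (suc n) - F n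
  1-t⊛-suc F n = trans (1-t⊛ F (suc n)) (+-congˡ (-‿cong (t⊛-suc F n)))

  -- With j = n ∸ k, its coefficients are the values at x = m + 1 of the k-th binomial in the
  -- Eulerian expansion of p_n.
  binomialSeries : ℕ → ℕ → R⟦t⟧
  binomialSeries n j m = ((m ℕ.+ j) choose n) × 1#

  private
    ×1-cong : ∀ {m n} → m ≡ n → m × 1# ≈ n × 1#
    ×1-cong = ×-congˡ {1#}

  -- Multiplication by 1 - t takes differences of consecutive coefficients, which Pascal's rule
  -- evaluates.
  1-t⊛binomialSeries : ∀ n → 1-t ⊛ binomialSeries (suc n) (suc n) ≋ binomialSeries n n
  1-t⊛binomialSeries n zero = trans (1-t⊛-zero (binomialSeries (suc n) (suc n)))
    (×1-cong (≡.trans (nCn≡1 (suc n)) (≡.sym (nCn≡1 n))))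
  1-t⊛binomialSeries n (suc m) = begin
    (1-t ⊛ binomialSeries (suc n) (suc n)) (suc m)
      ≈⟨ 1-t⊛-suc (binomialSeries (suc n) (suc n)) m ⟩
    ((suc N choose suc n) × 1#) - ((N choose suc n) × 1#)
      ≈⟨ +-congʳ (×1-cong (≡.sym (nCk+nC[k+1]≡[n+1]C[k+1] N n))) ⟩
    (((N choose n) ℕ.+ (N choose suc n)) × 1#) - ((N choose suc n) × 1#)
      ≈⟨ +-congʳ (×-homo-+ 1# (N choose n) (N choose suc n)) ⟩
    ((N choose n) × 1#) + ((N choose suc n) × 1#) - ((N choose suc n) × 1#)
      ≈⟨ [a+b]-b≈a _ _ ⟩
    (N choose n) × 1#
      ≈⟨ ×1-cong (≡.cong (_choose n) (ℕ.+-suc m n)) ⟩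
    ((suc m ℕ.+ n) choose n) × 1# ∎
    where N = m ℕ.+ suc n

  -- The negative binomial series: each factor 1 - t lowers `n` by one, until the geometric series
  -- remains.
  1-t^⊛binomialSeries : ∀ n → 1-t ^ˢ suc n ⊛ binomialSeries n n ≋ const 1#
  1-t^⊛binomialSeries zero n = begin
    ((1-t ⊛ const 1#) ⊛ binomialSeries 0 0) n   ≈⟨ ⊛-cong (S.*-identityʳ 1-t) (S.refl {binomialSeries 0 0}) n ⟩
    (1-t ⊛ binomialSeries 0 0) n                ≈⟨ geometric n ⟩
    const 1# n                                  ∎
    where
    geometric : 1-t ⊛ binomialSeries 0 0 ≋ const 1#
    geometric zero    = trans (1-t⊛-zero (binomialSeries 0 0)) (×-homo-1 1#)
    geometric (suc n) = trans (1-t⊛-suc (binomialSeries 0 0) n) (-‿inverseʳ _)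
  1-t^⊛binomialSeries (suc n) m = begin
    ((1-t ⊛ 1-t ^ˢ suc n) ⊛ binomialSeries (suc n) (suc n)) m
      ≈⟨ ⊛-cong (⊛-comm 1-t (1-t ^ˢ suc n)) (S.refl {binomialSeries (suc n) (suc n)}) m ⟩
    ((1-t ^ˢ suc n ⊛ 1-t) ⊛ binomialSeries (suc n) (suc n)) m
      ≈⟨ ⊛-assoc (1-t ^ˢ suc n) 1-t (binomialSeries (suc n) (suc n)) m ⟩
    (1-t ^ˢ suc n ⊛ (1-t ⊛ binomialSeries (suc n) (suc n))) m
      ≈⟨ ⊛-cong (S.refl {1-t ^ˢ suc n}) (1-t⊛binomialSeries n) m ⟩
    (1-t ^ˢ suc n ⊛ binomialSeries n n) m
      ≈⟨ 1-t^⊛binomialSeries n m ⟩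
    const 1# m ∎

  -- Passing from j + 1 to j moves all coefficients up by one place. The place that becomes free
  -- holds j choose n, which is 0 as long as j < n.
  binomialSeries-shift : ∀ n j → j < n → binomialSeries n j ≋ t ⊛ binomialSeries n (suc j)
  binomialSeries-shift n j j<n zero = trans (×1-cong (k>n⇒nCk≡0 j<n))
    (sym (t⊛-zero (binomialSeries n (suc j))))
  binomialSeries-shift n j j<n (suc m) = trans
    (×1-cong (≡.cong (_choose n) (≡.sym (ℕ.+-suc m j))))
    (sym (t⊛-suc (binomialSeries n (suc j)) m))

  binomialSeries-∸ : ∀ n k → k ≤ n → binomialSeries n (n ∸ k) ≋ t ^ˢ k ⊛ binomialSeries n n
  binomialSeries-∸ n zero    _   m = sym (⊛-identityˡ (binomialSeries n n) m)
  binomialSeries-∸ n (suc k) k<n m = begin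
    binomialSeries n (n ∸ suc k) m
      ≈⟨ binomialSeries-shift n (n ∸ suc k) (ℕ.∸-monoʳ-< {n} (s≤s z≤n) k<n) m ⟩
    (t ⊛ binomialSeries n (suc (n ∸ suc k))) m
      ≈⟨ ⊛-cong (S.refl {t}) (λ i → ×1-cong (≡.cong (λ j → (i ℕ.+ j) choose n) (≡.sym (ℕ.+-∸-assoc 1 k<n)))) m ⟩
    (t ⊛ binomialSeries n (n ∸ k)) m
      ≈⟨ ⊛-cong (S.refl {t}) (binomialSeries-∸ n k (ℕ.<⇒≤ k<n)) m ⟩
    (t ⊛ (t ^ˢ k ⊛ binomialSeries n n)) m
      ≈⟨ ⊛-assoc t (t ^ˢ k) (binomialSeries n n) m ⟨
    (t ^ˢ suc k ⊛ binomialSeries n n) m ∎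

  1-t^⊛binomialSeries-∸ : ∀ n k → k ≤ n →
    1-t ^ˢ suc n ⊛ binomialSeries n (n ∸ k) ≋ t ^ˢ k
  1-t^⊛binomialSeries-∸ n k k≤n m = begin
    (U ⊛ binomialSeries n (n ∸ k)) m        ≈⟨ ⊛-cong (S.refl {U}) (binomialSeries-∸ n k k≤n) m ⟩
    (U ⊛ (t ^ˢ k ⊛ binomialSeries n n)) m   ≈⟨ ⊛-assoc U (t ^ˢ k) (binomialSeries n n) m ⟨
    ((U ⊛ t ^ˢ k) ⊛ binomialSeries n n) m   ≈⟨ ⊛-cong (⊛-comm U (t ^ˢ k)) (S.refl {binomialSeries n n}) m ⟩
    ((t ^ˢ k ⊛ U) ⊛ binomialSeries n n) m   ≈⟨ ⊛-assoc (t ^ˢ k) U (binomialSeries n n) m ⟩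
    (t ^ˢ k ⊛ (U ⊛ binomialSeries n n)) m   ≈⟨ ⊛-cong (S.refl {t ^ˢ k}) (1-t^⊛binomialSeries n) m ⟩
    (t ^ˢ k ⊛ const 1#) m                   ≈⟨ S.*-identityʳ (t ^ˢ k) m ⟩
    (t ^ˢ k) m                              ∎
    where U = 1-t ^ˢ suc n

-- Clearing denominators and dilating an identity.

module SeriesIdentities {c ℓ} (R : CommutativeRing c ℓ) where

  open CommutativeRing R hiding (rawRing)
  open SeriesProperties R
  open CompositionProperties R
  open RingProperties S.ring using (-‿distribʳ-*)

  -- The bracketing and the factor `const 1#` reproduce the product of two quotients in the theorem.
  divide : ∀ {F G D G⁻¹ D⁻¹ N} → (F ⊛ G) ⊛ D ≋ N → G ⊛ G⁻¹ ≋ const 1# → D ⊛ D⁻¹ ≋ const 1# →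
    F ≋ (N ⊛ G⁻¹) ⊛ (const 1# ⊛ D⁻¹)
  divide {F} {G} {D} {G⁻¹} {D⁻¹} {N} FGD≋N GG⁻¹≋1 DD⁻¹≋1 = S.sym (begin
    (N ⊛ G⁻¹) ⊛ (const 1# ⊛ D⁻¹)           ≈⟨ S.*-congˡ {N ⊛ G⁻¹} (⊛-identityˡ D⁻¹) ⟩
    (N ⊛ G⁻¹) ⊛ D⁻¹                        ≈⟨ ⊛-cong (⊛-cong FGD≋N (S.refl {G⁻¹})) (S.refl {D⁻¹}) ⟨
    (((F ⊛ G) ⊛ D) ⊛ G⁻¹) ⊛ D⁻¹            ≈⟨ ⊛-assoc ((F ⊛ G) ⊛ D) G⁻¹ D⁻¹ ⟩
    ((F ⊛ G) ⊛ D) ⊛ (G⁻¹ ⊛ D⁻¹)            ≈⟨ S.*-congˡ {(F ⊛ G) ⊛ D} (⊛-comm G⁻¹ D⁻¹) ⟩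
    ((F ⊛ G) ⊛ D) ⊛ (D⁻¹ ⊛ G⁻¹)            ≈⟨ ⊛-assoc (F ⊛ G) D (D⁻¹ ⊛ G⁻¹) ⟩
    (F ⊛ G) ⊛ (D ⊛ (D⁻¹ ⊛ G⁻¹))            ≈⟨ S.*-congˡ {F ⊛ G} (⊛-assoc D D⁻¹ G⁻¹) ⟨
    (F ⊛ G) ⊛ ((D ⊛ D⁻¹) ⊛ G⁻¹)            ≈⟨ S.*-congˡ {F ⊛ G} (⊛-cong DD⁻¹≋1 (S.refl {G⁻¹})) ⟩
    (F ⊛ G) ⊛ (const 1# ⊛ G⁻¹)             ≈⟨ S.*-congˡ {F ⊛ G} (⊛-identityˡ G⁻¹) ⟩
    (F ⊛ G) ⊛ G⁻¹                          ≈⟨ ⊛-assoc F G G⁻¹ ⟩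
    F ⊛ (G ⊛ G⁻¹)                          ≈⟨ S.*-congˡ {F} GG⁻¹≋1 ⟩
    F ⊛ const 1#                           ≈⟨ S.*-identityʳ F ⟩
    F                                      ∎)
    where open ≈-Reasoning S.setoid

  ⊛-1⊖ : ∀ F a G → F ⊛ (const 1# ⊖ a · G) ≋ F ⊖ a · (F ⊛ G)
  ⊛-1⊖ F a G = begin
    F ⊛ (const 1# ⊖ a · G)                        ≈⟨ ⊛-distribˡ F (const 1#) (S.- (a · G)) ⟩
    F ⊛ const 1# ⊕ F ⊛ (S.- (a · G))              ≈⟨ S.+-cong (S.*-identityʳ F) (S.sym (-‿distribʳ-* F (a · G))) ⟩
    F ⊖ F ⊛ (a · G)                               ≈⟨ S.+-congˡ {F} (S.-‿cong (⊛-· a F G)) ⟩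
    F ⊖ a · (F ⊛ G)                               ∎
    where open ≈-Reasoning S.setoid

  -- Dilation is multiplicative and leaves constants and scalars alone, so it acts on the hypothesis
  -- factor by factor. The extra `u` goes to `F`, whose n-th coefficient thereby acquires the power
  -- n + 1 of `u`.
  scale : ∀ {F Γ E} u a → (F ⊛ Γ) ⊛ (const 1# ⊖ a · E) ≋ E →
    ((u · F ⟨ u t⟩) ⊛ Γ ⟨ u t⟩) ⊛ (const 1# ⊖ a · E ⟨ u t⟩) ≋ u · E ⟨ u t⟩
  scale {F} {Γ} {E} u a hyp = begin
    ((u · F ⟨ u t⟩) ⊛ Γ ⟨ u t⟩) ⊛ (const 1# ⊖ a · E ⟨ u t⟩)
      ≈⟨ ⊛-cong (·-⊛ u (F ⟨ u t⟩) (Γ ⟨ u t⟩)) (S.sym scale-1⊖) ⟩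
    (u · (F ⟨ u t⟩ ⊛ Γ ⟨ u t⟩)) ⊛ (const 1# ⊖ a · E) ⟨ u t⟩
      ≈⟨ ·-⊛ u (F ⟨ u t⟩ ⊛ Γ ⟨ u t⟩) ((const 1# ⊖ a · E) ⟨ u t⟩) ⟩
    u · ((F ⟨ u t⟩ ⊛ Γ ⟨ u t⟩) ⊛ (const 1# ⊖ a · E) ⟨ u t⟩)
      ≈⟨ ·-cong refl (⊛-cong (⟨t⟩-⊛ u F Γ) (S.refl {(const 1# ⊖ a · E) ⟨ u t⟩})) ⟨
    u · ((F ⊛ Γ) ⟨ u t⟩ ⊛ (const 1# ⊖ a · E) ⟨ u t⟩)
      ≈⟨ ·-cong refl (⟨t⟩-⊛ u (F ⊛ Γ) (const 1# ⊖ a · E)) ⟨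
    u · ((F ⊛ Γ) ⊛ (const 1# ⊖ a · E)) ⟨ u t⟩
      ≈⟨ ·-cong refl (⟨t⟩-cong u hyp) ⟩
    u · E ⟨ u t⟩ ∎
    where
    open ≈-Reasoning S.setoid
    scale-1⊖ : (const 1# ⊖ a · E) ⟨ u t⟩ ≋ const 1# ⊖ a · E ⟨ u t⟩
    scale-1⊖ n = trans (distribʳ _ _ _) (+-cong (⟨t⟩-const u 1# n)
      (trans (sym (RingProperties.-‿distribˡ-* ring _ _)) (-‿cong (*-assoc _ _ _))))

-- Two-variable series by rows and columns.

-- Series in t over R⟦x⟧, with the coefficient of tⁿxᵐ written F n m.
module BivariateSeries {c ℓ} (R : CommutativeRing c ℓ) where

  open CommutativeRing R hiding (rawRing)
  module SR = SeriesProperties R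
  module SS = SeriesProperties SR.seriesRing
  open BinomialSeries R using (t⊛-zero; t⊛-suc)
  open SeriesIdentities SR.seriesRing using (⊛-1⊖)
  open RawSemiringDefinitions (RawRing.rawSemiring (CommutativeRing.rawRing R))
    using (sum)
  open RawSemiringDefinitions (RawRing.rawSemiring SR.rawRing)
    using () renaming (sum to sumˢ)
  open MonoidSum +-commutativeMonoid using (sum-cong-≋)
  open RingProperties ring using (-0#≈0#)
  open ≈-Reasoning setoid

  sumˢ-coeff : ∀ N (F : Fin N → SR.R⟦t⟧) m → sumˢ {N} F m ≈ sum {N} λ k → F k m
  sumˢ-coeff zero    F m = SR.const0≈0 m
  sumˢ-coeff (suc N) F m = +-congˡ (sumˢ-coeff N (F ∘ fsuc) m)

  κ : SR.R⟦t⟧ → SS.R⟦t⟧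
  κ F n = SR.const (F n)

  row : SS.R⟦t⟧ → ℕ → SR.R⟦t⟧
  row F m n = F n m

  -- The coefficients of `κ G` are free of x, so multiplying by it does not mix the rows.
  row-⊛κ : ∀ F G m → row (F SS.⊛ κ G) m SR.≋ row F m SR.⊛ G
  row-⊛κ F G m n = trans
    (sumˢ-coeff (suc n) (λ k → F (toℕ k) SR.⊛ SR.const (G (n ∸ toℕ k))) m)
    (sum-cong-≋ {suc n} λ k → begin
      (F (toℕ k) SR.⊛ SR.const (G (n ∸ toℕ k))) m   ≈⟨ SR.⊛-comm (F (toℕ k)) (SR.const (G (n ∸ toℕ k))) m ⟩
      (SR.const (G (n ∸ toℕ k)) SR.⊛ F (toℕ k)) m   ≈⟨ SR.const-⊛ (G (n ∸ toℕ k)) (F (toℕ k)) m ⟩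
      G (n ∸ toℕ k) * F (toℕ k) m                   ≈⟨ *-comm _ _ ⟩
      F (toℕ k) m * G (n ∸ toℕ k)                   ∎)

  -- The rows of `F SS.⊛ κ Γ` start with `E` and each is the previous one times `E`. Multiplication
  -- by `SR.t`, which is x here, moves every row up by one; the subtraction therefore cancels all
  -- rows but the first, and no infinite sum has to be formed.
  geometric : ∀ F Γ E → row F 0 SR.⊛ Γ SR.≋ E →
    (∀ m → row F (suc m) SR.⊛ Γ SR.≋ (row F m SR.⊛ Γ) SR.⊛ E) →
    (F SS.⊛ κ Γ) SS.⊛ (SS.const (SR.const 1#) SS.⊖ SR.t SS.· κ E) SS.≋ κ E
  geometric F Γ E row₀ rows n m = trans (⊛-1⊖ W SR.t (κ E) n m) (coefficient m)
    where
    W = F SS.⊛ κ Γ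
    V = W SS.⊛ κ E
    coefficient : ∀ m → W n m - (SR.t SR.⊛ V n) m ≈ SR.const (E n) m
    coefficient zero = begin
      W n 0 - (SR.t SR.⊛ V n) 0     ≈⟨ +-cong (trans (row-⊛κ F Γ 0 n) (row₀ n)) (trans (-‿cong (t⊛-zero (V n))) -0#≈0#) ⟩
      E n + 0#                      ≈⟨ +-identityʳ _ ⟩
      E n                           ∎
    coefficient (suc m) = begin
      W n (suc m) - (SR.t SR.⊛ V n) (suc m)   ≈⟨ +-cong (row-⊛κ F Γ (suc m) n) (-‿cong (t⊛-suc (V n) m)) ⟩
      (row F (suc m) SR.⊛ Γ) n - V n m        ≈⟨ +-cong (rows m n) (-‿cong (row-⊛κ W E m n)) ⟩
      ((row F m SR.⊛ Γ) SR.⊛ E) n - (row W m SR.⊛ E) n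
        ≈⟨ +-congˡ (-‿cong (SR.⊛-cong (row-⊛κ F Γ m) (SR.S.refl {E}) n)) ⟩
      ((row F m SR.⊛ Γ) SR.⊛ E) n - ((row F m SR.⊛ Γ) SR.⊛ E) n
        ≈⟨ -‿inverseʳ _ ⟩
      0# ∎

-- Eulerian polynomials and values at positive integers.

module EulerianSeries {c ℓ₁ ℓ₂} (K : HeytingField c ℓ₁ ℓ₂) (char0 : CharacteristicZero K) where

  open Sheffer K char0
  open Polynomials K char0

  private
    R = commutativeRing K
    module K = HeytingField K
    module R = CommutativeRing R

  open R using ( _-_; refl; sym; trans; setoid; +-cong; +-congˡ; +-congʳ; +-comm; -‿cong
               ; *-cong; *-congˡ; *-congʳ; *-assoc; *-comm; *-identityˡ; *-identityʳ )
  open HeytingProperties K.heytingCommutativeRing using (x-0≈x)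
  open RawSemiringDefinitions (RawRing.rawSemiring rawRing) using (_×_; sum; product)
  open SemiringMult R.semiring using (×1-homo-*; ×-homo-1)
  open MonoidSum R.+-commutativeMonoid using (sum-cong-≋)
  open MonoidSum R.*-commutativeMonoid using () renaming (sum-cong-≋ to product-cong)
  open RawSemiringDefinitions P.rawSemiring
    using () renaming (sum to sumₚ; product to productₚ; _^_ to _^ₚ_)
  module PS = CompositionProperties polynomialRing
  open BivariateSeries R
  open BinomialSeries R
  open CompositionProperties R using (⊚-cong; ^ˢ-cong; ⊛-sum)
  open Exponential R 1/_!
  module coeff = SeriesHomomorphism polynomialRing SR.seriesRing coeff
    (IsRingMonomorphism.isRingHomomorphism coeff-isRingMonomorphism)
  module C = SeriesHomomorphism R polynomialRing C C-isRingHomomorphism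
  module eval (a : Carrier) =
    SeriesHomomorphism polynomialRing R (eval a) (eval-isRingHomomorphism a)

  *-inverse : ∀ {a} (a#0 : a # 0#) → a * inverse a#0 ≈ 1#
  *-inverse {a} a#0 = trans (*-congʳ (sym (x-0≈x a)))
    (proj₂ (proj₂ (K.#⇒invertible a#0)))

  n!*1/n!≈1 : ∀ n → ((n !) × 1#) * (1/ n !) ≈ 1#
  n!*1/n!≈1 n = *-inverse (char0 (n !) {{n ℕ.!≢0}})

  eval-fromℕ : ∀ a n → eval a (fromℕ n) ≈ n × 1#
  eval-fromℕ a zero    = refl
  eval-fromℕ a (suc n) = trans (eval-+ a (1# ∷ []) (fromℕ n))
    (+-cong (eval-C a 1#) (eval-fromℕ a n))

  eval-minus : ∀ a p q → eval a (p -ₚ q) ≈ eval a p - eval a q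
  eval-minus a p q = trans (eval-+ a p (map -_ q)) (+-congˡ (eval-neg a q))

  eval-product : ∀ a n (f : Fin n → K[x]) → eval a (productₚ {n} f) ≈ product {n} (eval a ∘ f)
  eval-product a zero    f = eval-C a 1#
  eval-product a (suc n) f = trans (eval-* a (f fzero) (productₚ {n} (f ∘ fsuc)))
    (*-congˡ (eval-product a n (f ∘ fsuc)))

  eval-binomial : ∀ a y n N → eval a y ≈ N × 1# → eval a (binomial y n) ≈ (N choose n) × 1#
  eval-binomial a y n N y≈N = begin
    eval a (productₚ {n} (λ i → y -ₚ fromℕ (toℕ i)) *ₚ C (1/ n !))
      ≈⟨ trans (eval-* a (productₚ {n} (λ i → y -ₚ fromℕ (toℕ i))) (C (1/ n !)))
           (*-cong (eval-product a n (λ i → y -ₚ fromℕ (toℕ i))) (eval-C a (1/ n !))) ⟩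
    product {n} (λ i → eval a (y -ₚ fromℕ (toℕ i))) * (1/ n !)
      ≈⟨ *-congʳ (product-cong {n} λ i → trans (eval-minus a y (fromℕ (toℕ i)))
           (+-cong y≈N (-‿cong (eval-fromℕ a (toℕ i))))) ⟩
    product {n} (λ i → (N × 1#) - (toℕ i × 1#)) * (1/ n !)
      ≈⟨ *-congʳ (trans (fallingFactorial N n) (trans (×1-homo-* (n !) (N choose n)) (*-comm _ _))) ⟩
    ((N choose n) × 1#) * ((n !) × 1#) * (1/ n !)
      ≈⟨ trans (*-assoc _ _ _) (*-congˡ (n!*1/n!≈1 n)) ⟩
    ((N choose n) × 1#) * 1#
      ≈⟨ *-identityʳ _ ⟩
    (N choose n) × 1# ∎
    where open ≈-Reasoning setoid

  eval-shifted : ∀ m n k → k ≤ n →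
    eval (suc m × 1#) (x +ₚ fromℕ n -ₚ fromℕ k -ₚ fromℕ 1) ≈ (m ℕ.+ (n ∸ k)) × 1#
  eval-shifted m n k k≤n = begin
    eval a (x +ₚ fromℕ n -ₚ fromℕ k -ₚ fromℕ 1)
      ≈⟨ trans (eval-minus a (x +ₚ fromℕ n -ₚ fromℕ k) (fromℕ 1)) (+-congʳ
           (trans (eval-minus a (x +ₚ fromℕ n) (fromℕ k)) (+-congʳ (eval-+ a x (fromℕ n))))) ⟩
    eval a x R.+ eval a (fromℕ n) - eval a (fromℕ k) - eval a (fromℕ 1)
      ≈⟨ +-cong (+-cong (+-cong (eval-x a) (eval-fromℕ a n)) (-‿cong (eval-fromℕ a k)))
           (-‿cong (eval-fromℕ a 1)) ⟩
    a + (n × 1#) - (k × 1#) - (1 × 1#)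
      ≈⟨ shifted-argument m k≤n ⟩
    (m ℕ.+ (n ∸ k)) × 1# ∎
    where
    open ≈-Reasoning setoid
    a = suc m × 1#

  -- Stands for the series of p(m + 1) xᵐ. Unlike `coeff`, this map from `K[x]` to K⟦x⟧ is linear
  -- but not multiplicative: x marks the point of evaluation and is not the variable of `p`.
  values : K[x] → SR.R⟦t⟧
  values p m = eval (suc m × 1#) p

  coeff-x : coeff x SR.≋ SR.t
  coeff-x zero          = refl
  coeff-x (suc zero)    = refl
  coeff-x (suc (suc n)) = refl

  coeff-1-x : coeff 1-x SR.≋ 1-t
  coeff-1-x n = trans (coeff-+ (1# ∷ []) (map -_ x) n)
    (+-cong (coeff-C 1# n) (trans (coeff-neg x n) (-‿cong (coeff-x n))))

  module _ (p : ℕ → K[x]) (A : (n : ℕ) → Fin (suc n) → Carrier) (isEulerian : IsEulerian p A) where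

    values-p : ∀ n → values (p n) SR.≋
      λ m → sum {suc n} λ k → A n k * binomialSeries n (n ∸ toℕ k) m
    values-p n m = begin
      eval a (p n)
        ≈⟨ eval-cong a (p n) (sumₚ {suc n} term) (isEulerian n) ⟩
      eval a (sumₚ {suc n} term)
        ≈⟨ eval.sum-homo a (suc n) term ⟩
      sum {suc n} (eval a ∘ term)
        ≈⟨ sum-cong-≋ {suc n} (λ k → trans (eval-* a (C (A n k)) (binomial (arg k) n))
             (*-cong (eval-C a (A n k))
               (eval-binomial a (arg k) n (m ℕ.+ (n ∸ toℕ k))
                 (eval-shifted m n (toℕ k) (Fin.toℕ≤pred[n] k))))) ⟩
      sum {suc n} (λ k → A n k * binomialSeries n (n ∸ toℕ k) m) ∎
      where
      open ≈-Reasoning setoid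
      a = suc m × 1#
      arg : Fin (suc n) → K[x]
      arg k = x +ₚ fromℕ n -ₚ fromℕ (toℕ k) -ₚ fromℕ 1
      term : Fin (suc n) → K[x]
      term k = C (A n k) *ₚ binomial (arg k) n

    -- Kept multiplied out, so that 1 - x never has to be inverted. By linearity each binomial
    -- series of the expansion contributes its own xᵏ.
    coeff-eulerianPolynomial : ∀ n →
      coeff (eulerianPolynomial A n) SR.≋ coeff 1-x SR.^ˢ suc n SR.⊛ values (p n)
    coeff-eulerianPolynomial n m = begin
      coeff (sumₚ {suc n} term) m
        ≈⟨ coeff.sum-homo (suc n) term m ⟩
      RawSeries.sum {suc n} (coeff ∘ term) m
        ≈⟨ sumˢ-coeff (suc n) (coeff ∘ term) m ⟩
      sum {suc n} (λ k → coeff (term k) m)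
        ≈⟨ sum-cong-≋ {suc n} (λ k → coeff-term k) ⟩
      sum {suc n} (λ k → A n k * (1-t SR.^ˢ suc n SR.⊛ binomialSeries n (n ∸ toℕ k)) m)
        ≈⟨ ⊛-sum (1-t SR.^ˢ suc n) (suc n) (A n) (λ k → binomialSeries n (n ∸ toℕ k)) m ⟨
      (1-t SR.^ˢ suc n SR.⊛ (λ i → sum {suc n} λ k → A n k * binomialSeries n (n ∸ toℕ k) i)) m
        ≈⟨ SR.⊛-cong (^ˢ-cong coeff-1-x (suc n)) (values-p n) m ⟨
      (coeff 1-x SR.^ˢ suc n SR.⊛ values (p n)) m ∎
      where
      open ≈-Reasoning setoid
      module RawSeries = RawSemiringDefinitions (RawRing.rawSemiring SR.rawRing)
      term : Fin (suc n) → K[x]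
      term k = C (A n k) *ₚ x ^ₚ toℕ k
      coeff-term : ∀ k → coeff (term k) m ≈
        A n k * (1-t SR.^ˢ suc n SR.⊛ binomialSeries n (n ∸ toℕ k)) m
      coeff-term k = begin
        coeff (term k) m
          ≈⟨ coeff-* (C (A n k)) (x ^ₚ toℕ k) m ⟩
        (coeff (C (A n k)) SR.⊛ coeff (x ^ₚ toℕ k)) m
          ≈⟨ SR.⊛-cong (coeff-C (A n k)) (λ i → trans (coeff.^-homo x (toℕ k) i) (^ˢ-cong coeff-x (toℕ k) i)) m ⟩
        (SR.const (A n k) SR.⊛ SR.t SR.^ˢ toℕ k) m
          ≈⟨ SR.const-⊛ (A n k) (SR.t SR.^ˢ toℕ k) m ⟩
        A n k * (SR.t SR.^ˢ toℕ k) m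
          ≈⟨ *-congˡ (1-t^⊛binomialSeries-∸ n (toℕ k) (Fin.toℕ≤pred[n] k) m) ⟨
        A n k * (1-t SR.^ˢ suc n SR.⊛ binomialSeries n (n ∸ toℕ k)) m ∎

  module _ (g f̄ : K⟦t⟧) (g₀#0 : g 0 # 0#) (f̄₀≈0 : f̄ 0 ≈ 0#) where

    γ e q : K⟦t⟧
    γ = g SR.⊚ f̄
    e = exp SR.⊚ f̄
    q = S₀.const 1# ÷₀ γ [ ⊚-const#0 g f̄ g₀#0 ]

    exp-multiple : ℕ → K⟦t⟧
    exp-multiple m = exp SR.⊚ ((m × 1#) SR.· f̄)

    exp-multiple-1 : exp-multiple 1 SR.≋ e
    exp-multiple-1 = ⊚-cong (SR.S.refl {exp}) λ n → trans (*-congʳ (×-homo-1 1#)) (*-identityˡ _)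

    exp-multiple-suc : ∀ m → exp-multiple (suc m) SR.≋ exp-multiple m SR.⊛ e
    exp-multiple-suc m n = begin
      exp-multiple (suc m) n
        ≈⟨ ⊚-cong (SR.S.refl {exp}) (λ i → *-congʳ (+-comm 1# (m × 1#))) n ⟩
      (exp SR.⊚ (((m × 1#) R.+ 1#) SR.· f̄)) n
        ≈⟨ exp-⊚-⊛ n!*1/n!≈1 f̄ f̄₀≈0 (m × 1#) 1# n ⟨
      (exp-multiple m SR.⊛ (exp SR.⊚ (1# SR.· f̄))) n
        ≈⟨ SR.⊛-cong (SR.S.refl {exp-multiple m})
             (⊚-cong (SR.S.refl {exp}) λ i → *-identityˡ (f̄ i)) n ⟩
      (exp-multiple m SR.⊛ e) n ∎
      where open ≈-Reasoning setoid

    q⊛γ : q SR.⊛ γ SR.≋ SR.const 1#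
    q⊛γ n = begin
      (q SR.⊛ γ) n      ≈⟨ SR.⊛-cong (SR.⊛-identityˡ γ⁻¹) (SR.S.refl {γ}) n ⟩
      (γ⁻¹ SR.⊛ γ) n    ≈⟨ SR.⊛-comm γ⁻¹ γ n ⟩
      (γ SR.⊛ γ⁻¹) n    ≈⟨ SR.⊛-reciprocal _ γ (*-inverse (⊚-const#0 g f̄ g₀#0)) n ⟩
      SR.const 1# n     ∎
      where
      open ≈-Reasoning setoid
      γ⁻¹ = SR.reciprocal (inverse (⊚-const#0 g f̄ g₀#0)) γ

    module _ (p : ℕ → K[x]) (isSheffer : IsSheffer g f̄ g₀#0 p) where

      -- The array through which both hypotheses communicate: its columns, in x, carry the Eulerian
      -- expansion, and its rows, in t, the Sheffer property.
      valuesₑ : SS.R⟦t⟧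
      valuesₑ n = values (p n) SR.⊛ SR.const (1/ n !)

      -- Evaluation at m + 1 is a ring homomorphism, so it passes through the product and the
      -- composition in the Sheffer identity, sending x to m + 1 and fixing the coefficients from
      -- `K`.
      row-values : ∀ m → row valuesₑ m SR.≋ q SR.⊛ exp-multiple (suc m)
      row-values m n = begin
        (values (p n) SR.⊛ SR.const (1/ n !)) m
          ≈⟨ SR.⊛-comm (values (p n)) (SR.const (1/ n !)) m ⟩
        (SR.const (1/ n !) SR.⊛ values (p n)) m
          ≈⟨ trans (SR.const-⊛ (1/ n !) (values (p n)) m) (*-comm _ _) ⟩
        eval a (p n) * (1/ n !)
          ≈⟨ trans (eval-* a (p n) (C (1/ n !))) (*-congˡ (eval-C a (1/ n !))) ⟨
        eval a (egf p n)
          ≈⟨ eval-cong a (egf p n) (((C ∘ q) Sₚ.⊛ expₚ (x Sₚ.· (C ∘ f̄))) n) (isSheffer n) ⟩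
        eval a (((C ∘ q) Sₚ.⊛ expₚ (x Sₚ.· (C ∘ f̄))) n)
          ≈⟨ eval.⊛-homo a (C ∘ q) (expₚ (x Sₚ.· (C ∘ f̄))) n ⟩
        ((eval a ∘ C ∘ q) SR.⊛ (eval a ∘ expₚ (x Sₚ.· (C ∘ f̄)))) n
          ≈⟨ SR.⊛-cong (λ i → eval-C a (q i)) (λ i → trans
               (eval.⊚-homo a (C ∘ exp) (x Sₚ.· (C ∘ f̄)) i)
               (⊚-cong (λ k → eval-C a (exp k)) (λ k → trans (eval-* a x (C (f̄ k)))
                 (*-cong (eval-x a) (eval-C a (f̄ k)))) i)) n ⟩
        (q SR.⊛ exp-multiple (suc m)) n ∎
        where
        open ≈-Reasoning setoid
        a = suc m × 1#

      row-values-⊛ : ∀ m → row valuesₑ m SR.⊛ γ SR.≋ exp-multiple (suc m)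
      row-values-⊛ m n = begin
        (row valuesₑ m SR.⊛ γ) n              ≈⟨ SR.⊛-cong (row-values m) (SR.S.refl {γ}) n ⟩
        ((q SR.⊛ E) SR.⊛ γ) n                 ≈⟨ SR.⊛-cong (SR.⊛-comm q E) (SR.S.refl {γ}) n ⟩
        ((E SR.⊛ q) SR.⊛ γ) n                 ≈⟨ SR.⊛-assoc E q γ n ⟩
        (E SR.⊛ (q SR.⊛ γ)) n                 ≈⟨ SR.⊛-cong (SR.S.refl {E}) q⊛γ n ⟩
        (E SR.⊛ SR.const 1#) n                ≈⟨ SR.S.*-identityʳ E n ⟩
        E n                                   ∎
        where
        open ≈-Reasoning setoid
        E = exp-multiple (suc m)

      values-⊛ : (valuesₑ SS.⊛ κ γ) SS.⊛ (SS.const (SR.const 1#) SS.⊖ SR.t SS.· κ e) SS.≋ κ e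
      values-⊛ = geometric valuesₑ γ e
        -- Row 0 belongs to the value at x = 1, so it equals `e` and not 1. This is the origin of
        -- the exponential in the numerator of the theorem.
        (λ n → trans (row-values-⊛ 0 n) (exp-multiple-1 n))
        (λ m n → trans (row-values-⊛ (suc m) n) (trans (exp-multiple-suc (suc m) n)
          (sym (SR.⊛-cong (row-values-⊛ m) (SR.S.refl {e}) n))))

      module _ (A : (n : ℕ) → Fin (suc n) → Carrier) (isEulerian : IsEulerian p A) where

        u : SR.R⟦t⟧
        u = coeff 1-x

        -- Of the n + 1 factors 1 - x, the dilation absorbs n; the remaining one is the prefactor 1
        -- - x of the theorem.
        coeff-egf : coeff ∘ egf (eulerianPolynomial A) SS.≋ u SS.· valuesₑ SS.⟨ u t⟩
        coeff-egf n = begin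
          coeff (eulerianPolynomial A n *ₚ C (1/ n !))
            ≈⟨ coeff-* (eulerianPolynomial A n) (C (1/ n !)) ⟩
          coeff (eulerianPolynomial A n) SR.⊛ coeff (C (1/ n !))
            ≈⟨ SR.⊛-cong (coeff-eulerianPolynomial p A isEulerian n) (coeff-C (1/ n !)) ⟩
          ((u SR.⊛ u SR.^ˢ n) SR.⊛ values (p n)) SR.⊛ SR.const (1/ n !)
            ≈⟨ SR.⊛-assoc (u SR.⊛ u SR.^ˢ n) (values (p n)) (SR.const (1/ n !)) ⟩
          (u SR.⊛ u SR.^ˢ n) SR.⊛ valuesₑ n
            ≈⟨ SR.⊛-assoc u (u SR.^ˢ n) (valuesₑ n) ⟩
          u SR.⊛ (u SR.^ˢ n SR.⊛ valuesₑ n)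
            ≈⟨ SR.⊛-cong (SR.S.refl {u}) (SR.⊛-comm (u SR.^ˢ n) (valuesₑ n)) ⟩
          u SR.⊛ (valuesₑ n SR.⊛ u SR.^ˢ n) ∎
          where open ≈-Reasoning SR.S.setoid

        coeff-[1-x]t : ∀ h → coeff ∘ (h [1-x]t) SS.≋ κ h SS.⟨ u t⟩
        coeff-[1-x]t h n m = trans (coeff.⟨t⟩-homo (C ∘ h) 1-x n m)
          (SR.⊛-cong (coeff-C (h n)) (SR.S.refl {u SR.^ˢ n}) m)

        -- Dilation commutes with composition in the inner series, and `C` commutes with composition
        -- as a ring homomorphism. Hence composing with f̄ may be done over `K`, where γ and e were
        -- formed.
        ⊚-[1-x]t : ∀ h → (C ∘ h) Sₚ.⊚ (f̄ [1-x]t) Sₚ.≋ (h SR.⊚ f̄) [1-x]t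
        ⊚-[1-x]t h n m = trans (sym (PS.⟨t⟩-⊚ 1-x (C ∘ h) (C ∘ f̄) n m))
          (sym (PS.⟨t⟩-cong {C ∘ (h SR.⊚ f̄)} {(C ∘ h) Sₚ.⊚ (C ∘ f̄)} 1-x (C.⊚-homo h f̄) n m))

        coeff-⊚-[1-x]t : ∀ h → coeff ∘ ((C ∘ h) Sₚ.⊚ (f̄ [1-x]t)) SS.≋ κ (h SR.⊚ f̄) SS.⟨ u t⟩
        coeff-⊚-[1-x]t h n m = trans (⊚-[1-x]t h n m) (coeff-[1-x]t (h SR.⊚ f̄) n m)

        E G D : K[x]⟦t⟧
        E = expₚ (f̄ [1-x]t)
        G = (C ∘ g) Sₚ.⊚ (f̄ [1-x]t)
        D = Sₚ.const P.1# Sₚ.⊖ x Sₚ.· E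

        coeff-D : coeff ∘ D SS.≋ SS.const (SR.const 1#) SS.⊖ SR.t SS.· κ e SS.⟨ u t⟩
        coeff-D n m = trans (coeff-+ (Sₚ.const P.1# n) (map -_ (x *ₚ E n)) m) (+-cong
          (trans (coeff.const-homo P.1# n m) (const-coeff1 n m))
          (trans (coeff-neg (x *ₚ E n) m) (-‿cong (trans (coeff-* x (E n) m)
            (SR.⊛-cong coeff-x (coeff-⊚-[1-x]t exp n) m)))))
          where
          const-coeff1 : SS.const (coeff P.1#) SS.≋ SS.const (SR.const 1#)
          const-coeff1 zero    = coeff-C 1#
          const-coeff1 (suc n) = SR.S.refl {SR.const 0#}

        -- The theorem with its denominators cleared. All factors have coefficients in `K[x]`, so it
        -- can be checked after `coeff` and then carried to K(x).
        egf-⊛ : (egf (eulerianPolynomial A) Sₚ.⊛ G) Sₚ.⊛ D Sₚ.≋ 1-x Sₚ.· E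
        egf-⊛ n = begin
          coeff (((a Sₚ.⊛ G) Sₚ.⊛ D) n)
            ≈⟨ coeff.⊛-homo (a Sₚ.⊛ G) D n ⟩
          ((coeff ∘ (a Sₚ.⊛ G)) SS.⊛ (coeff ∘ D)) n
            ≈⟨ SS.⊛-cong (λ i → SR.S.trans (coeff.⊛-homo a G i) (SS.⊛-cong coeff-egf (coeff-⊚-[1-x]t g) i)) coeff-D n ⟩
          (((u SS.· valuesₑ SS.⟨ u t⟩) SS.⊛ κ γ SS.⟨ u t⟩) SS.⊛ (SS.const (SR.const 1#) SS.⊖ SR.t SS.· κ e SS.⟨ u t⟩)) n
            ≈⟨ SeriesIdentities.scale SR.seriesRing {valuesₑ} {κ γ} {κ e} u SR.t values-⊛ n ⟩
          u SR.⊛ (κ e SS.⟨ u t⟩) n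
            ≈⟨ SR.⊛-cong (SR.S.refl {u}) (coeff-⊚-[1-x]t exp n) ⟨
          u SR.⊛ coeff (E n)
            ≈⟨ coeff-* 1-x (E n) ⟨
          coeff (1-x *ₚ E n) ∎
          where
          open ≈-Reasoning SR.S.setoid
          a = egf (eulerianPolynomial A)

theorem3p3 : ∀ {c ℓ₁ ℓ₂} (K : HeytingField c ℓ₁ ℓ₂) (char0 : CharacteristicZero K) →
    let open Sheffer K char0 in
    (g f f̄ : K⟦t⟧) (g₀#0 : g 0 # 0#) → f 0 ≈ 0# → f 1 # 0# →
    IsCompositionalInverse f f̄ →
    (p : ℕ → K[x]) → IsSheffer g f̄ g₀#0 p →
    (A : (n : ℕ) → Fin (suc n) → Carrier) → IsEulerian p A →
    let H = f̄ [1-x]t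
        E = expₚ H
    in
    (ι ∘ egf (eulerianPolynomial A)) Sᵣ.≋
    ((1-x Sₚ.· E) ÷ ((C ∘ g) Sₚ.⊚ H) [ ⊚ₚ-const≢0 g H g₀#0 ])
      Sᵣ.⊛ (Sₚ.const P.1# ÷ (Sₚ.const P.1# Sₚ.⊖ x Sₚ.· E) [ 1-x·exp-const≢0 H ])
theorem3p3 K char0 g f f̄ g₀#0 _ _ f̄-inverse p isSheffer A isEulerian n =
  RS.S.trans {ι ∘ a} {(ι ∘ N) RS.⊛ G⁻¹ RS.⊛ (RS.const (ι P.1#) RS.⊛ D⁻¹)}
    {(ι ∘ N) RS.⊛ G⁻¹ RS.⊛ ((ι ∘ Sₚ.const P.1#) RS.⊛ D⁻¹)}
    (SeriesIdentities.divide rationalRing {ι ∘ a} {ι ∘ G} {ι ∘ D} {G⁻¹} {D⁻¹} {ι ∘ N}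
      a⊛G⊛D≋N
      (RS.⊛-reciprocal _ (ι ∘ G) (ι-inverseʳ (G 0) G₀≢0))
      (RS.⊛-reciprocal _ (ι ∘ D) (ι-inverseʳ (D 0) D₀≢0)))
    -- `divide` yields the constant series of `ι P.1#`, whereas the quotient in the statement has
    -- the image under `ι` of a constant series as its numerator.
    (RS.S.*-congˡ {(ι ∘ N) RS.⊛ G⁻¹} {RS.const (ι P.1#) RS.⊛ D⁻¹} {(ι ∘ Sₚ.const P.1#) RS.⊛ D⁻¹}
      (RS.S.*-congʳ {D⁻¹} {RS.const (ι P.1#)} {ι ∘ Sₚ.const P.1#}
        (RS.S.sym {ι ∘ Sₚ.const P.1#} {RS.const (ι P.1#)} (ι-hom.const-homo P.1#))))
    n
  where
  open Sheffer K char0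
  open Polynomials K char0
  open EulerianSeries K char0 using (egf-⊛)
  module RS = SeriesProperties rationalRing
  module ι-hom = SeriesHomomorphism polynomialRing rationalRing ι ι-isRingHomomorphism
  H E G D N a : K[x]⟦t⟧
  H = f̄ [1-x]t
  E = expₚ H
  G = (C ∘ g) Sₚ.⊚ H
  D = Sₚ.const P.1# Sₚ.⊖ x Sₚ.· E
  N = 1-x Sₚ.· E
  a = egf (eulerianPolynomial A)
  G₀≢0 : Nonzeroₚ (G 0)
  G₀≢0 = ⊚ₚ-const≢0 g H g₀#0
  D₀≢0 : Nonzeroₚ (D 0)
  D₀≢0 = 1-x·exp-const≢0 H
  G⁻¹ D⁻¹ : K⟨x⟩⟦t⟧
  G⁻¹ = RS.reciprocal (inverseᵣ (ι (G 0)) G₀≢0) (ι ∘ G)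
  D⁻¹ = RS.reciprocal (inverseᵣ (ι (D 0)) D₀≢0) (ι ∘ D)
  a⊛G⊛D≋N : ((ι ∘ a) RS.⊛ (ι ∘ G)) RS.⊛ (ι ∘ D) RS.≋ ι ∘ N
  -- Both products are pulled back through `ι` to series over `K[x]`, where `egf-⊛` applies.
  a⊛G⊛D≋N = RS.S.trans {((ι ∘ a) RS.⊛ (ι ∘ G)) RS.⊛ (ι ∘ D)} {(ι ∘ (a Sₚ.⊛ G)) RS.⊛ (ι ∘ D)} {ι ∘ N}
    (RS.S.*-congʳ {ι ∘ D} {(ι ∘ a) RS.⊛ (ι ∘ G)} {ι ∘ (a Sₚ.⊛ G)}
      (RS.S.sym {ι ∘ (a Sₚ.⊛ G)} {(ι ∘ a) RS.⊛ (ι ∘ G)} (ι-hom.⊛-homo a G)))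
    (RS.S.trans {(ι ∘ (a Sₚ.⊛ G)) RS.⊛ (ι ∘ D)} {ι ∘ ((a Sₚ.⊛ G) Sₚ.⊛ D)} {ι ∘ N}
      (RS.S.sym {ι ∘ ((a Sₚ.⊛ G) Sₚ.⊛ D)} {(ι ∘ (a Sₚ.⊛ G)) RS.⊛ (ι ∘ D)}
        (ι-hom.⊛-homo (a Sₚ.⊛ G) D))
      (λ i → IsRingHomomorphism.⟦⟧-cong ι-isRingHomomorphism {((a Sₚ.⊛ G) Sₚ.⊛ D) i} {N i}
        (egf-⊛ g f̄ g₀#0 (IsCompositionalInverse.f̄₀≈0 f̄-inverse) p isSheffer A isEulerian i)))
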